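{- Let $\widehat P_4$ denote the suspension of the path $P_4$ on four vertices, i.e. the $5$-vertex graph obtained from $P_4$ by adding one new vertex adjacent to all four vertices of $P_4$. For every integer $n\ge 8$, \[ \mathrm{ex}(n, K_3, \widehat P_4) = \left\lfloor \frac{n^2}{8}\right\rfloor . \] Moreover, $\mathrm{ex}(n,K_3,\widehat P_4)$ equals $4,4,5,8$ for $n=4,5,6,7$ respectively.
   Context: All graphs are finite and simple. For graphs $T$ and $H$, the generalized Turán number $\mathrm{ex}(n,T,H)$ is the maximum number of (not necessarily induced) copies of $T$ in an $n$-vertex graph that contains no copy of $H$ as a (not necessarily induced) subgraph. $K_3$ is the triangle, so $\mathrm{ex}(n,K_3,H)$ is the maximum number of triangles in an $n$-vertex $H$-free graph. $P_4$ is the path on $4$ vertices. -}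

module Defs where

open import Data.Nat using (ℕ; zero; suc; _≤_; _<ᵇ_)
open import Data.Fin using (Fin; toℕ) renaming (zero to f0; suc to fs)
open import Data.Bool using (Bool; true; false; _∧_; if_then_else_)
open import Data.List using (List; map; allFin)
open import Data.Nat.ListAction using (sum)
open import Data.Product using (Σ; _×_; ∃)
open import Relation.Binary.PropositionalEquality using (_≡_)
open import Relation.Nullary using (¬_)
open import Function.Definitions using (Injective)

record Graph (n : ℕ) : Set where
  field
    adj   : Fin n → Fin n → Bool
    sym   : ∀ i j → adj i j ≡ adj j i
    irrefl : ∀ i → adj i i ≡ false
open Graph public

Contains : ∀ {n k} → Graph n → Graph k → Set
Contains {n} {k} G H =
  Σ (Fin k → Fin n) λ f → Injective _≡_ _≡_ f ×
    (∀ i j → adj H i j ≡ true → adj G (f i) (f j) ≡ true)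

Free : ∀ {n k} → Graph n → Graph k → Set
Free G H = ¬ Contains G H

isTri : ∀ {n} → Graph n → Fin n → Fin n → Fin n → Bool
isTri G a b c = (toℕ a <ᵇ toℕ b) ∧ (toℕ b <ᵇ toℕ c)
                ∧ adj G a b ∧ adj G b c ∧ adj G a c

triangles : ∀ {n} → Graph n → ℕ
triangles {n} G =
  sum (map (λ a → sum (map (λ b → sum (map (λ c →
    if isTri G a b c then 1 else 0) (allFin n))) (allFin n))) (allFin n))

ExK3 : ∀ {k} → ℕ → Graph k → ℕ → Set
ExK3 n H m =
  (Σ (Graph n) λ G → Free G H × triangles G ≡ m) ×
  (∀ (G : Graph n) → Free G H → triangles G ≤ m)

-- The suspension of P₄: path 0-1-2-3 plus apex 4 adjacent to 0,1,2,3.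
p4adj : Fin 5 → Fin 5 → Bool
p4adj f0 (fs f0) = true
p4adj (fs f0) f0 = true
p4adj (fs f0) (fs (fs f0)) = true
p4adj (fs (fs f0)) (fs f0) = true
p4adj (fs (fs f0)) (fs (fs (fs f0))) = true
p4adj (fs (fs (fs f0))) (fs (fs f0)) = true
p4adj (fs (fs (fs (fs f0)))) (fs (fs (fs (fs f0)))) = false
p4adj (fs (fs (fs (fs f0)))) _ = true
p4adj _ (fs (fs (fs (fs f0)))) = true
p4adj _ _ = false

P4hat : Graph 5
P4hat = record { adj = p4adj ; sym = s ; irrefl = r }
  where
  open Relation.Binary.PropositionalEquality using (refl)
  s : ∀ i j → p4adj i j ≡ p4adj j i
  s f0 f0 = refl
  s f0 (fs f0) = refl
  s f0 (fs (fs f0)) = refl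
  s f0 (fs (fs (fs f0))) = refl
  s f0 (fs (fs (fs (fs f0)))) = refl
  s (fs f0) f0 = refl
  s (fs f0) (fs f0) = refl
  s (fs f0) (fs (fs f0)) = refl
  s (fs f0) (fs (fs (fs f0))) = refl
  s (fs f0) (fs (fs (fs (fs f0)))) = refl
  s (fs (fs f0)) f0 = refl
  s (fs (fs f0)) (fs f0) = refl
  s (fs (fs f0)) (fs (fs f0)) = refl
  s (fs (fs f0)) (fs (fs (fs f0))) = refl
  s (fs (fs f0)) (fs (fs (fs (fs f0)))) = refl
  s (fs (fs (fs f0))) f0 = refl
  s (fs (fs (fs f0))) (fs f0) = refl
  s (fs (fs (fs f0))) (fs (fs f0)) = refl
  s (fs (fs (fs f0))) (fs (fs (fs f0))) = refl
  s (fs (fs (fs f0))) (fs (fs (fs (fs f0)))) = refl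
  s (fs (fs (fs (fs f0)))) f0 = refl
  s (fs (fs (fs (fs f0)))) (fs f0) = refl
  s (fs (fs (fs (fs f0)))) (fs (fs f0)) = refl
  s (fs (fs (fs (fs f0)))) (fs (fs (fs f0))) = refl
  s (fs (fs (fs (fs f0)))) (fs (fs (fs (fs f0)))) = refl
  r : ∀ i → p4adj i i ≡ false
  r f0 = refl
  r (fs f0) = refl
  r (fs (fs f0)) = refl
  r (fs (fs (fs f0))) = refl
  r (fs (fs (fs (fs f0)))) = refl

{-# OPTIONS --safe #-}
module Submission where

-- A graph is P̂₄-free iff every link (the graph induced on a neighbourhood) is P₄-free, i.e. has only triangles and
-- stars as components; such a link has at most as many edges as vertices, and fewer as soon as some component is a star.
--
-- Without K₄ all links are star forests, so at least two edges of every triangle are private, that is, lie in no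
-- other triangle. Let v have the largest number Δ of private neighbours. Every triangle has at least two
-- (private edge, endpoint outside the private neighbourhood of v) incidences, so twice the number t of triangles is
-- at most (n ∸ Δ) Δ ≤ n²/4, as in Mantel's theorem.
--
-- If S is a K₄, a vertex outside S has at most one neighbour in S. Deleting S therefore destroys n ∸ defect triangles,
-- where the defect counts the star components of the links of S outside S and the vertices not adjacent to S; since
-- n²/8 drops by n ∸ 2, a defect of 2 is enough for induction. The defects of two disjoint K₄'s deleted one after the
-- other sum to at least 4, which settles the case of two disjoint K₄'s (three are needed when the remainder has
-- exactly one further K₄ up to disjointness). Otherwise all K₄'s meet: if just one K₄ exists and a triangle avoids it,
-- its defect is at least 2; if two K₄'s share v and the defect is below 2, then two vertices of the first one have no
-- outside neighbours and deleting these two destroys only four triangles, enough for n ≥ 10 (n = 8, 9 are counted directly).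

open import Defs hiding (sym) renaming (irrefl to adj-irrefl)
open import Data.Nat as ℕ hiding (_≟_)
open import Data.Nat.Properties hiding (_≟_)
open import Data.Nat.DivMod
open import Data.Nat.Divisibility using (divides-refl)
open import Data.Nat.ListAction using (sum)
open import Data.Nat.ListAction.Properties using (sum-++; sum-↭)
open import Data.Nat.Tactic.RingSolver using (solve-∀)
open import Data.Bool as Bool using (Bool; true; false; not; _∧_; _∨_; if_then_else_)
import Data.Bool.Properties as Bool
open import Data.Fin as Fin using (Fin; toℕ) renaming (zero to f0; suc to fs)
import Data.Fin.Properties as Fin
open import Data.List as List using (List; []; _∷_; _++_; map; length; filter; allFin)
import Data.List.Properties as List
open import Data.List.Membership.Propositional using (_∈_; _∉_; find; lose)
open import Data.List.Membership.Propositional.Properties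
open import Data.List.Relation.Binary.Permutation.Propositional
  using (_↭_; refl; prep; swap; ↭-sym; ↭-trans; ↭⇒↭ₛ)
open import Data.List.Relation.Binary.Permutation.Propositional.Properties
  using (∈-resp-↭; map⁺; ↭-length; shift; shifts; filter-↭; ++⁺ˡ; ++⁺ʳ)
import Data.List.Relation.Binary.Permutation.Setoid.Properties as PermS
open import Data.List.Relation.Unary.All as All using (All; []; _∷_)
open import Data.List.Relation.Unary.AllPairs as AllPairs using (AllPairs; []; _∷_)
import Data.List.Relation.Unary.AllPairs.Properties as AllPairs
open import Data.List.Relation.Unary.Any using (Any; here; there; any?)
open import Data.List.Relation.Unary.Unique.Propositional using (Unique)
import Data.List.Relation.Unary.Unique.Propositional.Properties as Unique
open import Data.Vec using (lookup; []; _∷_)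
import Data.Vec.Relation.Unary.All as VecAll
import Data.Vec.Relation.Unary.AllPairs as VecPairs
open import Data.Vec.Relation.Unary.Unique.Propositional.Properties using (lookup-injective)
open import Data.Product using (Σ; ∃; _×_; _,_; proj₁; proj₂)
open import Data.Sum using (_⊎_; inj₁; inj₂)
open import Data.Empty using (⊥; ⊥-elim)
open import Function using (_∘_; id)
open import Function.Bundles using (Equivalence)
open import Level using (0ℓ)
open import Relation.Binary using (Rel; Decidable; Symmetric; DecidableEquality)
open import Relation.Binary.PropositionalEquality hiding ([_])
open import Relation.Nullary
import Relation.Unary as U

-- Finite sums and duplicate-free lists.

∑ : {A : Set} → List A → (A → ℕ) → ℕ
∑ L f = sum (map f L)

module _ {A : Set} where

  ∑-mono : (L : List A) {f g : A → ℕ} → (∀ {x} → x ∈ L → f x ≤ g x) → ∑ L f ≤ ∑ L g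
  ∑-mono []      f≤g = z≤n
  ∑-mono (x ∷ L) f≤g = +-mono-≤ (f≤g (here refl)) (∑-mono L (f≤g ∘ there))

  ∑-cong : (L : List A) {f g : A → ℕ} → (∀ {x} → x ∈ L → f x ≡ g x) → ∑ L f ≡ ∑ L g
  ∑-cong []      f≡g = refl
  ∑-cong (x ∷ L) f≡g = cong₂ _+_ (f≡g (here refl)) (∑-cong L (f≡g ∘ there))

  ∑-+ : (L : List A) (f g : A → ℕ) → ∑ L (λ x → f x + g x) ≡ ∑ L f + ∑ L g
  ∑-+ []      f g = refl
  ∑-+ (x ∷ L) f g rewrite ∑-+ L f g = swap-mid (f x) (g x) (∑ L f) (∑ L g)
    where
    swap-mid : ∀ a b c d → a + b + (c + d) ≡ a + c + (b + d)
    swap-mid = solve-∀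

  ∑-++ : (K L : List A) (f : A → ℕ) → ∑ (K ++ L) f ≡ ∑ K f + ∑ L f
  ∑-++ K L f = trans (cong sum (List.map-++ f K L)) (sum-++ (map f K) (map f L))

  ∑-↭ : {K L : List A} (f : A → ℕ) → K ↭ L → ∑ K f ≡ ∑ L f
  ∑-↭ f p = sum-↭ (map⁺ f p)

  ∑-const : (L : List A) (c : ℕ) → ∑ L (λ _ → c) ≡ length L * c
  ∑-const []      c = refl
  ∑-const (x ∷ L) c = cong (c +_) (∑-const L c)

  ∑-zero : (L : List A) {f : A → ℕ} → (∀ {x} → x ∈ L → f x ≡ 0) → ∑ L f ≡ 0
  ∑-zero L f≡0 = trans (∑-cong L f≡0) (trans (∑-const L 0) (*-zeroʳ (length L)))

  ∑-filter : {P : A → Set} (P? : U.Decidable P) (L : List A) (f : A → ℕ) → ∑ (filter P? L) f ≤ ∑ L f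
  ∑-filter P? []      f = z≤n
  ∑-filter P? (x ∷ L) f with does (P? x)
  ... | true  = +-monoʳ-≤ (f x) (∑-filter P? L f)
  ... | false = m≤n⇒m≤o+n (f x) (∑-filter P? L f)

  ∈⇒↭ : {L : List A} {x : A} → x ∈ L → ∃ λ L′ → L ↭ x ∷ L′
  ∈⇒↭ x∈L with ys , zs , refl ← ∈-∃++ x∈L = ys ++ zs , shift _ ys zs

  Unique-↭ : {K L : List A} → K ↭ L → Unique K → Unique L
  Unique-↭ p = PermS.Unique-resp-↭ (setoid A) (↭⇒↭ₛ p)

  Unique-++ʳ : (K : List A) {L : List A} → Unique (K ++ L) → Unique L
  Unique-++ʳ []      u       = u
  Unique-++ʳ (x ∷ K) (_ ∷ u) = Unique-++ʳ K u

  Unique-disjoint : (K : List A) {L : List A} {x : A} → Unique (K ++ L) → x ∈ K → x ∉ L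
  Unique-disjoint (y ∷ K) (d ∷ u) (here refl) x∈L = All.lookup d (∈-++⁺ʳ K x∈L) refl
  Unique-disjoint (y ∷ K) (d ∷ u) (there x∈K) x∈L = Unique-disjoint K u x∈K x∈L

  ∈-∷⁻ : {x y : A} {L : List A} → x ∈ y ∷ L → x ≢ y → x ∈ L
  ∈-∷⁻ (here e)  x≢y = ⊥-elim (x≢y e)
  ∈-∷⁻ (there m) x≢y = m

  second-member : {M : List A} {c : A} → Unique M → c ∈ M → length M ≢ 1 → ∃ λ x → x ∈ M × x ≢ c
  second-member {_ ∷ []}    u                c∈M ≢1 = ⊥-elim (≢1 refl)
  second-member {x ∷ y ∷ M} ((x≢y ∷ _) ∷ _) (here refl) ≢1 = y , there (here refl) , x≢y ∘ sym
  second-member {x ∷ y ∷ M} (d ∷ _) (there c∈M) ≢1 = x , here refl , λ { refl → All.lookup d c∈M refl }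

  ≤1-equal : {M : List A} {x y : A} → length M ≤ 1 → x ∈ M → y ∈ M → x ≡ y
  ≤1-equal {_ ∷ []} _ (here refl) (here refl) = refl
  ≤1-equal {_ ∷ _ ∷ _} (s≤s ())

  all-equal-≤1 : {M : List A} → Unique M → (∀ {x y} → x ∈ M → y ∈ M → x ≡ y) → length M ≤ 1
  all-equal-≤1 {[]} u h = z≤n
  all-equal-≤1 {x ∷ []} u h = s≤s z≤n
  all-equal-≤1 {x ∷ y ∷ M} ((x≢y ∷ _) ∷ _) h = ⊥-elim (x≢y (h (here refl) (there (here refl))))

  no-members : {M : List A} → (∀ {x} → x ∉ M) → M ≡ []
  no-members {[]}    h = refl
  no-members {x ∷ M} h = ⊥-elim (h (here refl))

  module _ {P Q : A → Set} (P? : U.Decidable P) (Q? : U.Decidable Q) where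
    filter-comm : (L : List A) → filter P? (filter Q? L) ≡ filter Q? (filter P? L)
    filter-comm [] = refl
    filter-comm (x ∷ L) with P? x in ep | Q? x in eq
    ... | yes _ | yes _ rewrite ep | eq = cong (x ∷_) (filter-comm L)
    ... | yes _ | no _  rewrite eq = filter-comm L
    ... | no _  | yes _ rewrite ep = filter-comm L
    ... | no _  | no _  = filter-comm L

𝟙 : Bool → ℕ
𝟙 b = if b then 1 else 0

∑-* : {A : Set} (L : List A) (c : ℕ) (f : A → ℕ) → ∑ L (λ x → c * f x) ≡ c * ∑ L f
∑-* []      c f = sym (*-zeroʳ c)
∑-* (x ∷ L) c f rewrite ∑-* L c f = sym (*-distribˡ-+ c (f x) (∑ L f))

∑-𝟙 : {A : Set} {P : A → Set} (P? : U.Decidable P) (L : List A) →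
  ∑ L (λ x → 𝟙 (does (P? x))) ≡ length (filter P? L)
∑-𝟙 P? []      = refl
∑-𝟙 P? (x ∷ L) with does (P? x)
... | true  = cong suc (∑-𝟙 P? L)
... | false = ∑-𝟙 P? L

maximum : {A : Set} (f : A → ℕ) (x : A) (L : List A) →
  ∃ λ v → v ∈ x ∷ L × (∀ {u} → u ∈ x ∷ L → f u ≤ f v)
maximum f x [] = x , here refl , λ { (here refl) → ≤-refl }
maximum f x (y ∷ L) with maximum f y L
... | v , v∈ , max with ≤-total (f x) (f v)
... | inj₁ x≤v = v , there v∈ , λ { (here refl) → x≤v ; (there u∈) → max u∈ }
... | inj₂ v≤x = x , here refl , λ { (here refl) → ≤-refl ; (there u∈) → ≤-trans (max u∈) v≤x }

-- Edges, triangles and double counting on lists of vertices.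

choose₂ choose₃ : ℕ → ℕ
choose₂ zero    = 0
choose₂ (suc n) = n + choose₂ n
choose₃ zero    = 0
choose₃ (suc n) = choose₂ n + choose₃ n

choose₂-mono : ∀ {m n} → m ≤ n → choose₂ m ≤ choose₂ n
choose₂-mono z≤n       = z≤n
choose₂-mono (s≤s m≤n) = +-mono-≤ m≤n (choose₂-mono m≤n)

module Counting {V : Set} {_~_ : Rel V 0ℓ} (_~?_ : Decidable _~_) where

  N : V → List V → List V
  N v L = filter (v ~?_) L

  -- Vertex sets are lists, so deletion and restriction to a link are list operations. An edge is
  -- counted at the endpoint that comes first; by `edges-↭` and `tri-↭` the order does not matter.
  edges : List V → ℕ
  edges []      = 0
  edges (x ∷ L) = length (N x L) + edges L

  tri : List V → ℕ
  tri []      = 0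
  tri (x ∷ L) = edges (N x L) + tri L

  |N|≤ : ∀ v L → length (N v L) ≤ length L
  |N|≤ v []      = z≤n
  |N|≤ v (x ∷ L) with does (v ~? x)
  ... | true  = s≤s (|N|≤ v L)
  ... | false = m≤n⇒m≤1+n (|N|≤ v L)

  edges≤choose₂ : ∀ L → edges L ≤ choose₂ (length L)
  edges≤choose₂ []      = z≤n
  edges≤choose₂ (x ∷ L) = +-mono-≤ (|N|≤ x L) (edges≤choose₂ L)

  tri≤choose₃ : ∀ L → tri L ≤ choose₃ (length L)
  tri≤choose₃ []      = z≤n
  tri≤choose₃ (x ∷ L) = +-mono-≤ (≤-trans (edges≤choose₂ (N x L)) (choose₂-mono (|N|≤ x L))) (tri≤choose₃ L)

  N⁺ : ∀ {v x L} → x ∈ L → v ~ x → x ∈ N v L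
  N⁺ {v} = ∈-filter⁺ (v ~?_)

  N⁻ : ∀ {v x} L → x ∈ N v L → x ∈ L × v ~ x
  N⁻ {v} L = ∈-filter⁻ (v ~?_) {xs = L}

  N-++ : ∀ v K L → N v (K ++ L) ≡ N v K ++ N v L
  N-++ v = List.filter-++ (v ~?_)

  N-none : ∀ v L → (∀ {x} → x ∈ L → ¬ v ~ x) → N v L ≡ []
  N-none v L h = no-members λ x∈ → let x∈L , v~x = N⁻ L x∈ in h x∈L v~x

  N-all : ∀ v L → (∀ {x} → x ∈ L → v ~ x) → N v L ≡ L
  N-all v L h = List.filter-all (v ~?_) (All.tabulate h)

  N-yes : ∀ {v x} L → v ~ x → N v (x ∷ L) ≡ x ∷ N v L
  N-yes {v} L = List.filter-accept (v ~?_)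

  N-no : ∀ {v x} L → ¬ v ~ x → N v (x ∷ L) ≡ N v L
  N-no {v} L = List.filter-reject (v ~?_)

  N-unique : ∀ v {L} → Unique L → Unique (N v L)
  N-unique v = Unique.filter⁺ (v ~?_)

  edges-++ : ∀ K L → (∀ {x y} → x ∈ K → y ∈ L → ¬ x ~ y) → edges (K ++ L) ≡ edges K + edges L
  edges-++ []      L h = refl
  edges-++ (x ∷ K) L h
    rewrite N-++ x K L | N-none x L (h (here refl)) | edges-++ K L (h ∘ there)
          | List.length-++ (N x K) {[]} | +-identityʳ (length (N x K))
    = sym (+-assoc (length (N x K)) (edges K) (edges L))

  edges>0⇒edge : ∀ L → 0 < edges L → ∃ λ a → ∃ λ b → (a ∈ L × b ∈ L) × a ~ b
  edges>0⇒edge (a ∷ L) h with N a L in eq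
  ... | b ∷ _ = let b∈L , a~b = N⁻ {a} {b} L (subst (b ∈_) (sym eq) (here refl))
                in a , b , (here refl , there b∈L) , a~b
  ... | [] = let b , c , (b∈L , c∈L) , b~c = edges>0⇒edge L h
             in b , c , (there b∈L , there c∈L) , b~c

  tri>0⇒triangle : ∀ L → 0 < tri L →
    ∃ λ a → ∃ λ b → ∃ λ c → (a ∈ L × b ∈ L × c ∈ L) × (a ~ b × a ~ c × b ~ c)
  tri>0⇒triangle (x ∷ L) h with edges (N x L) in eq
  ... | zero = let a , b , c , (i , j , k) , r = tri>0⇒triangle L h
               in a , b , c , (there i , there j , there k) , r
  ... | suc _ = let b , c , (b∈ , c∈) , b~c = edges>0⇒edge (N x L) (subst (0 <_) (sym eq) (s≤s z≤n))
                    b∈L , x~b = N⁻ {x} {b} L b∈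
                    c∈L , x~c = N⁻ {x} {c} L c∈
                in x , b , c , (here refl , there b∈L , there c∈L) , (x~b , x~c , b~c)

  -- An edge occurs on the right in both orders, which together weigh at least 2; the other ordered
  -- pairs, diagonal included, only add.
  2edges≤∑ : (h : V → V → ℕ) (M : List V) → (∀ {b c} → b ∈ M → c ∈ M → b ~ c → 2 ≤ h b c + h c b) →
    2 * edges M ≤ ∑ M (λ b → ∑ M (h b))
  2edges≤∑ h []      H = z≤n
  2edges≤∑ h (y ∷ M) H = begin
    2 * (length (N y M) + edges M)                                  ≡⟨ *-distribˡ-+ 2 (length (N y M)) (edges M) ⟩
    2 * length (N y M) + 2 * edges M                                ≤⟨ +-mono-≤ at-y (2edges≤∑ h M (λ b c → H (there b) (there c))) ⟩
    ∑ M (λ c → h y c + h c y) + ∑ M (λ b → ∑ M (h b))               ≡⟨ cong (_+ ∑ M (λ b → ∑ M (h b))) (∑-+ M (h y) (λ c → h c y)) ⟩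
    ∑ M (h y) + ∑ M (λ c → h c y) + ∑ M (λ b → ∑ M (h b))           ≡⟨ +-assoc (∑ M (h y)) _ _ ⟩
    ∑ M (h y) + (∑ M (λ c → h c y) + ∑ M (λ b → ∑ M (h b)))         ≡⟨ cong (∑ M (h y) +_) (∑-+ M (λ c → h c y) (λ b → ∑ M (h b))) ⟨
    ∑ M (h y) + ∑ M (λ b → h b y + ∑ M (h b))                       ≤⟨ m≤n+m _ (h y y) ⟩
    h y y + (∑ M (h y) + ∑ M (λ b → h b y + ∑ M (h b)))             ≡⟨ +-assoc (h y y) _ _ ⟨
    ∑ (y ∷ M) (λ b → ∑ (y ∷ M) (h b))                               ∎
    where
    open ≤-Reasoning
    at-y : 2 * length (N y M) ≤ ∑ M (λ c → h y c + h c y)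
    at-y = begin
      2 * length (N y M)                   ≡⟨ *-comm 2 (length (N y M)) ⟩
      length (N y M) * 2                   ≡⟨ ∑-const (N y M) 2 ⟨
      ∑ (N y M) (λ _ → 2)                  ≤⟨ ∑-mono (N y M) (λ c∈ → let c∈M , y~c = N⁻ M c∈ in H (here refl) (there c∈M) y~c) ⟩
      ∑ (N y M) (λ c → h y c + h c y)      ≤⟨ ∑-filter (y ~?_) M _ ⟩
      ∑ M (λ c → h y c + h c y)            ∎

  ∑³ : List V → (V → V → V → ℕ) → ℕ
  ∑³ L g = ∑ L λ a → ∑ L λ b → ∑ L λ c → g a b c

  -- The hypothesis adds up the six orders of a triangle. When the head x is split off, the three
  -- places it can take in a triple give the weight `h` of an ordered pair, and `2edges≤∑` applies
  -- to the link of x.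
  2tri≤∑ : (g : V → V → V → ℕ) (L : List V) →
    (∀ {a b c} → a ∈ L → b ∈ L → c ∈ L → a ~ b → a ~ c → b ~ c →
      2 ≤ (g a b c + g b a c + g b c a) + (g a c b + g c a b + g c b a)) →
    2 * tri L ≤ ∑³ L g
  2tri≤∑ g []      H = z≤n
  2tri≤∑ g (x ∷ L) H = begin
    2 * (edges (N x L) + tri L)                    ≡⟨ *-distribˡ-+ 2 (edges (N x L)) (tri L) ⟩
    2 * edges (N x L) + 2 * tri L                  ≤⟨ +-mono-≤ at-x (2tri≤∑ g L (λ a b c → H (there a) (there b) (there c))) ⟩
    ∑ L (λ b → ∑ L (h b)) + ∑³ L g                 ≡⟨ cong (_+ ∑³ L g) h-sum ⟩
    (S₁ + S₂ + S₃) + ∑³ L g                        ≡⟨ arith S₁ S₂ S₃ (∑³ L g) ⟩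
    S₁ + (S₂ + (S₃ + ∑³ L g))                      ≡⟨ cong (λ k → S₁ + (S₂ + k)) (trans (∑-cong L λ {a} _ → ∑-+ L (λ b → g a b x) (λ b → ∑ L (g a b))) (∑-+ L _ _)) ⟨
    S₁ + (S₂ + ∑ L (λ a → ∑ L λ b → g a b x + ∑ L (g a b)))   ≡⟨ cong (S₁ +_) (∑-+ L _ _) ⟨
    S₁ + ∑ L (λ a → ∑ L (g a x) + ∑ L λ b → g a b x + ∑ L (g a b))
      ≤⟨ +-mono-≤ (m≤n⇒m≤o+n _ (∑-mono L λ {b} _ → m≤n+m _ (g x b x)))
                  (∑-mono L λ {a} _ → +-monoˡ-≤ _ (m≤n+m _ (g a x x))) ⟩
    ∑³ (x ∷ L) g ∎
    where
    open ≤-Reasoning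
    h : V → V → ℕ
    h b c = g x b c + g b x c + g b c x
    S₁ = ∑ L λ b → ∑ L λ c → g x b c
    S₂ = ∑ L λ b → ∑ L λ c → g b x c
    S₃ = ∑ L λ b → ∑ L λ c → g b c x
    arith : ∀ a b c d → a + b + c + d ≡ a + (b + (c + d))
    arith = solve-∀
    h-sum : ∑ L (λ b → ∑ L (h b)) ≡ S₁ + S₂ + S₃
    h-sum = trans
      (∑-cong L λ {b} _ → trans (∑-+ L (λ c → g x b c + g b x c) (λ c → g b c x))
        (cong (_+ ∑ L (λ c → g b c x)) (∑-+ L (g x b) (g b x))))
      (trans (∑-+ L _ _) (cong (_+ S₃) (∑-+ L _ _)))
    at-x : 2 * edges (N x L) ≤ ∑ L (λ b → ∑ L (h b))
    at-x = begin
      2 * edges (N x L)                     ≤⟨ 2edges≤∑ h (N x L) (λ b∈ c∈ b~c →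
                                                let b∈L , x~b = N⁻ L b∈ ; c∈L , x~c = N⁻ L c∈
                                                in H (here refl) (there b∈L) (there c∈L) x~b x~c b~c) ⟩
      ∑ (N x L) (λ b → ∑ (N x L) (h b))     ≤⟨ ∑-mono (N x L) (λ {b} _ → ∑-filter (x ~?_) L (h b)) ⟩
      ∑ (N x L) (λ b → ∑ L (h b))           ≤⟨ ∑-filter (x ~?_) L _ ⟩
      ∑ L (λ b → ∑ L (h b))                 ∎

  module _ (~-sym : Symmetric _~_) where

    |N|-cons : ∀ v x L → length (N v (x ∷ L)) ≡ length (N v (x ∷ [])) + length (N v L)
    |N|-cons v x L with does (v ~? x)
    ... | true  = refl
    ... | false = refl

    |N|-sym : ∀ x y → length (N x (y ∷ [])) ≡ length (N y (x ∷ []))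
    |N|-sym x y with x ~? y | y ~? x
    ... | yes _   | yes _   = refl
    ... | no _    | no _    = refl
    ... | yes x~y | no y≁x  = ⊥-elim (y≁x (~-sym x~y))
    ... | no x≁y  | yes y~x = ⊥-elim (x≁y (~-sym y~x))

    edges-↭ : ∀ {K L} → K ↭ L → edges K ≡ edges L
    edges-↭ refl = refl
    edges-↭ (prep x p) = cong₂ _+_ (↭-length (filter-↭ (x ~?_) p)) (edges-↭ p)
    edges-↭ {_ ∷ _ ∷ K} {_ ∷ _ ∷ L} (swap x y p)
      rewrite |N|-cons x y K | |N|-cons y x L | |N|-sym x y
            | ↭-length (filter-↭ (x ~?_) p) | ↭-length (filter-↭ (y ~?_) p) | edges-↭ p
      = arith (length (N y (x ∷ []))) (length (N x L)) (length (N y L)) (edges L)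
      where
      arith : ∀ a b c d → a + b + (c + d) ≡ a + c + (b + d)
      arith = solve-∀
    edges-↭ (_↭_.trans p q) = trans (edges-↭ p) (edges-↭ q)

    tri-↭ : ∀ {K L} → K ↭ L → tri K ≡ tri L
    tri-↭ refl = refl
    tri-↭ (prep x p) = cong₂ _+_ (edges-↭ (filter-↭ (x ~?_) p)) (tri-↭ p)
    tri-↭ {_ ∷ _ ∷ K} {_ ∷ _ ∷ L} (swap x y p) = trans swap-heads
      (cong₂ _+_ (edges-↭ (filter-↭ (y ~?_) (prep x p)))
        (cong₂ _+_ (edges-↭ (filter-↭ (x ~?_) p)) (tri-↭ p)))
      where
      swap-front : ∀ a b c → a + (b + c) ≡ b + (a + c)
      swap-front = solve-∀
      swap-front′ : ∀ d a b c → d + a + (b + c) ≡ d + b + (a + c)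
      swap-front′ = solve-∀
      swap-heads : tri (x ∷ y ∷ K) ≡ tri (y ∷ x ∷ K)
      swap-heads with x ~? y | y ~? x
      ... | no _    | no _    = swap-front (edges (N x K)) (edges (N y K)) (tri K)
      ... | yes x~y | no y≁x  = ⊥-elim (y≁x (~-sym x~y))
      ... | no x≁y  | yes y~x = ⊥-elim (x≁y (~-sym y~x))
      ... | yes _   | yes _
        rewrite filter-comm (y ~?_) (x ~?_) K
        = swap-front′ (length (N x (N y K))) (edges (N x K)) (edges (N y K)) (tri K)
    tri-↭ (_↭_.trans p q) = trans (tri-↭ p) (tri-↭ q)

    ∑-degree-cons : ∀ S x X (f : V → ℕ) →
      ∑ S (λ v → f v * length (N v (x ∷ X))) ≡ ∑ (N x S) f + ∑ S (λ v → f v * length (N v X))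
    ∑-degree-cons [] x X f = refl
    ∑-degree-cons (v ∷ S) x X f rewrite ∑-degree-cons S x X f with v ~? x | x ~? v
    ... | yes _   | yes _   = arith (f v) (length (N v X)) (∑ (N x S) f) _
      where
      arith : ∀ a b c d → a * suc b + (c + d) ≡ a + c + (a * b + d)
      arith = solve-∀
    ... | no _    | no _    = arith (f v * length (N v X)) (∑ (N x S) f) _
      where
      arith : ∀ a b c → a + (b + c) ≡ b + (a + c)
      arith = solve-∀
    ... | yes v~x | no x≁v  = ⊥-elim (x≁v (~-sym v~x))
    ... | no v≁x  | yes x~v = ⊥-elim (v≁x (~-sym x~v))

    -- Double counting of the edges between S and X, each weighted by its end in S.
    ∑-degree-swap : ∀ S X (f : V → ℕ) →
      ∑ S (λ v → f v * length (N v X)) ≡ ∑ X (λ x → ∑ (N x S) f)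
    ∑-degree-swap S [] f = ∑-zero S (λ {v} _ → *-zeroʳ (f v))
    ∑-degree-swap S (x ∷ X) f =
      trans (∑-degree-cons S x X f) (cong (∑ (N x S) f +_) (∑-degree-swap S X f))

-- P₄-free graphs: edges against vertices.

module Links {V : Set} {_~_ : Rel V 0ℓ} (_~?_ : Decidable _~_)
  (~-sym : Symmetric _~_) (~-irrefl : ∀ {x} → ¬ x ~ x) where

  open Counting _~?_ public

  ~⇒≢ : ∀ {x y} → x ~ y → x ≢ y
  ~⇒≢ x~y refl = ~-irrefl x~y

  -- Consecutive vertices differ by irreflexivity; the three remaining pairs are required to be
  -- distinct.
  PathFree : List V → Set
  PathFree M = ∀ {a b c d} → a ∈ M → b ∈ M → c ∈ M → d ∈ M →
    a ~ b → b ~ c → c ~ d → a ≢ c → b ≢ d → a ≢ d → ⊥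

  PathFree-⊆ : ∀ {K M} → (∀ {x} → x ∈ K → x ∈ M) → PathFree M → PathFree K
  PathFree-⊆ K⊆M pf a b c d = pf (K⊆M a) (K⊆M b) (K⊆M c) (K⊆M d)

  -- When M is the link `N v X` and u one of its vertices, this says that v and u lie in a K₄ whose
  -- other two vertices are in X.
  InTriangle : V → List V → Set
  InTriangle u M = ∃ λ a → ∃ λ b → (a ∈ M × b ∈ M) × (u ~ a × u ~ b × a ~ b)

  inTriangle? : ∀ u M → Dec (InTriangle u M)
  inTriangle? u M with any? (λ a → any? (λ b → (u ~? a) ×-dec (u ~? b) ×-dec (a ~? b)) M) M
  ... | yes p = let a , a∈ , q = find p ; b , b∈ , r = find q in yes (a , b , (a∈ , b∈) , r)
  ... | no ¬p = no λ { (a , b , (a∈ , b∈) , r) → ¬p (lose a∈ (lose b∈ r)) }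

  InTriangle-⊆ : ∀ {u K M} → (∀ {x} → x ∈ K → x ∈ M) → InTriangle u K → InTriangle u M
  InTriangle-⊆ K⊆M (a , b , (a∈ , b∈) , r) = a , b , (K⊆M a∈ , K⊆M b∈) , r

  private
    StrictBound WeakBound : List V → Set
    WeakBound M = Unique M → PathFree M → edges M ≤ length M
    StrictBound M = ∀ {u} → u ∈ M → ¬ InTriangle u M → Unique M → PathFree M → edges M < length M

    -- Case split on the neighbours of u in M. With none, u adds a vertex and no edge. With a single
    -- one, y, it is y that lies in no triangle of M. With two or more, y is a leaf, and deleting it
    -- costs one vertex and one edge.
    strict-head : ∀ {u M} → Unique (u ∷ M) → PathFree (u ∷ M) → ¬ InTriangle u (u ∷ M) →
      WeakBound M → StrictBound M → (∀ {K} → length K ≡ length M → StrictBound K) →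
      edges (u ∷ M) < suc (length M)
    strict-head {u} {M} uq@(u∉M ∷ uqM) pf u-free weak strict strict′ = go (N u M) refl
      where
      pfM : PathFree M
      pfM = PathFree-⊆ there pf
      u≢ : ∀ {x} → x ∈ M → u ≢ x
      u≢ = All.lookup u∉M
      go : ∀ ns → N u M ≡ ns → edges (u ∷ M) < suc (length M)
      go [] eq rewrite eq = s≤s (weak uqM pfM)
      go (y ∷ []) eq rewrite eq = s≤s (strict y∈M y-free uqM pfM)
        where
        y∈ : y ∈ M × u ~ y
        y∈ = N⁻ M (subst (y ∈_) (sym eq) (here refl))
        y∈M = proj₁ y∈
        -- A triangle y a b would give the path u y a b.
        y-free : ¬ InTriangle y M
        y-free (a , b , (a∈ , b∈) , (y~a , y~b , a~b)) =
          pf (here refl) (there y∈M) (there a∈) (there b∈) (proj₂ y∈) y~a a~b (u≢ a∈) (~⇒≢ y~b) (u≢ b∈)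
      go (y ∷ z ∷ ns) eq with ∈⇒↭ (proj₁ (N⁻ {u} {y} M (subst (y ∈_) (sym eq) (here refl))))
      ... | M′ , M↭ = begin-strict
        edges (u ∷ M)                                    ≡⟨ edges-↭ ~-sym uM↭ ⟩
        length (N y (u ∷ M′)) + edges (u ∷ M′)           ≡⟨ cong (λ K → length K + edges (u ∷ M′)) N≡ ⟩
        suc (edges (u ∷ M′))                             <⟨ s≤s (strict′ len (here refl) u-free′ uq′ pf′) ⟩
        suc (suc (length M′))                            ≡⟨ cong suc len ⟩
        suc (length M)                                   ∎
        where
        open ≤-Reasoning
        uM↭ : u ∷ M ↭ y ∷ u ∷ M′
        uM↭ = ↭-trans (prep u M↭) (swap u y refl)
        len : length (u ∷ M′) ≡ length M
        len = sym (↭-length M↭)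
        sub : ∀ {x} → x ∈ u ∷ M′ → x ∈ u ∷ M
        sub x∈ = ∈-resp-↭ (↭-sym uM↭) (there x∈)
        uq″ : Unique (y ∷ u ∷ M′)
        uq″ = Unique-↭ uM↭ uq
        uq′ = AllPairs.tail uq″
        pf′ = PathFree-⊆ sub pf
        u-free′ : ¬ InTriangle u (u ∷ M′)
        u-free′ = u-free ∘ InTriangle-⊆ sub
        y∈ = N⁻ {u} {y} M (subst (y ∈_) (sym eq) (here refl))
        z∈ = N⁻ {u} {z} M (subst (z ∈_) (sym eq) (there (here refl)))
        y≢z : y ≢ z
        y≢z with subst Unique eq (N-unique u uqM)
        ... | (y≢z ∷ _) ∷ _ = y≢z
        -- A further neighbour w of y gives the path w y u z or, when w is z, the triangle u y z.
        y-leaf : ∀ {w} → w ∈ M′ → ¬ y ~ w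
        y-leaf {w} w∈ y~w = pf (sub (there w∈)) (there (proj₁ y∈)) (here refl) (there (proj₁ z∈))
          (~-sym y~w) (~-sym (proj₂ y∈)) (proj₂ z∈)
          (All.lookup (AllPairs.head uq′) w∈ ∘ sym) y≢z
          λ { refl → u-free (y , z , (there (proj₁ y∈) , there (proj₁ z∈)) , (proj₂ y∈ , proj₂ z∈ , y~w)) }
        N≡ : N y (u ∷ M′) ≡ u ∷ []
        N≡ = trans (N-yes M′ (~-sym (proj₂ y∈))) (cong (u ∷_) (N-none y M′ y-leaf))

    mutual
      strict : ∀ k {M} → length M ≤ k → StrictBound M
      strict zero    {[]} len ()
      strict (suc k) {M} len {u} u∈M u-free uq pf with ∈⇒↭ u∈M
      ... | M′ , M↭ = subst₂ _<_ (sym (edges-↭ ~-sym M↭)) (sym (↭-length M↭))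
        (strict-head (Unique-↭ M↭ uq) (PathFree-⊆ sub pf) (u-free ∘ InTriangle-⊆ sub)
          (weak k len′) (strict k len′) λ e → strict k (≤-trans (≤-reflexive e) len′))
        where
        sub : ∀ {x} → x ∈ u ∷ M′ → x ∈ M
        sub = ∈-resp-↭ (↭-sym M↭)
        len′ : length M′ ≤ k
        len′ = ≤-pred (≤-trans (≤-reflexive (sym (↭-length M↭))) len)

      -- A triangle through the head is a whole component, since a further vertex adjacent to it
      -- would start a path through its three vertices. Removing it takes away three vertices and at
      -- most three edges. The number `k` bounds the length for termination.
      weak : ∀ k {M} → length M ≤ k → WeakBound M
      weak k {[]} len uq pf = z≤n
      weak k {x ∷ M} len uq pf with inTriangle? x (x ∷ M)
      ... | no ¬t = <⇒≤ (strict k len (here refl) ¬t uq pf)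
      weak (suc k) {x ∷ M} len uq@(x∉M ∷ uqM) pf | yes (a , b , (a∈ , b∈) , (x~a , x~b , a~b))
        with ∈⇒↭ (∈-∷⁻ a∈ (~⇒≢ x~a ∘ sym))
      ... | K , M↭ with ∈⇒↭ (∈-∷⁻ (∈-resp-↭ M↭ (∈-∷⁻ b∈ (~⇒≢ x~b ∘ sym))) (~⇒≢ a~b ∘ sym))
      ... | L , K↭ = begin
        edges (x ∷ M)                                ≡⟨ edges-↭ ~-sym xM↭ ⟩
        edges (T ++ L)                               ≡⟨ edges-++ T L isolated ⟩
        edges T + edges L                            ≤⟨ +-mono-≤ (edges≤choose₂ T) (weak k len′ uqL (PathFree-⊆ (sub ∘ ∈-++⁺ʳ T) pf)) ⟩
        3 + length L                                 ≡⟨ ↭-length xM↭ ⟨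
        length (x ∷ M)                               ∎
        where
        open ≤-Reasoning
        T = x ∷ a ∷ b ∷ []
        xM↭ : x ∷ M ↭ T ++ L
        xM↭ = prep x (↭-trans M↭ (prep a K↭))
        sub : ∀ {y} → y ∈ T ++ L → y ∈ x ∷ M
        sub = ∈-resp-↭ (↭-sym xM↭)
        uqT = Unique-↭ xM↭ uq
        uqL : Unique L
        uqL = Unique-++ʳ T uqT
        len′ : length L ≤ k
        len′ = m+n≤o⇒n≤o 2 (≤-pred (≤-trans (≤-reflexive (sym (↭-length xM↭))) len))
        isolated′ : ∀ {p q r y} → p ∈ T → q ∈ T → r ∈ T → y ∈ L → p ~ q → q ~ r → p ≢ r → ¬ p ~ y
        isolated′ p q r y p~q q~r p≢r p~y =
          pf (sub (∈-++⁺ʳ T y)) (sub (∈-++⁺ˡ p)) (sub (∈-++⁺ˡ q)) (sub (∈-++⁺ˡ r)) (~-sym p~y) p~q q~r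
            (λ { refl → Unique-disjoint T uqT q y }) p≢r (λ { refl → Unique-disjoint T uqT r y })
        isolated : ∀ {p y} → p ∈ T → y ∈ L → ¬ p ~ y
        isolated p@(here refl) y =
          isolated′ p (there (here refl)) (there (there (here refl))) y x~a a~b (~⇒≢ x~b)
        isolated p@(there (here refl)) y =
          isolated′ p (here refl) (there (there (here refl))) y (~-sym x~a) x~b (~⇒≢ a~b)
        isolated p@(there (there (here refl))) y =
          isolated′ p (here refl) (there (here refl)) y (~-sym x~b) x~a (~⇒≢ a~b ∘ sym)

  pathFree⇒edges≤ : ∀ M → Unique M → PathFree M → edges M ≤ length M
  pathFree⇒edges≤ M = weak (length M) ≤-refl

  pathFree⇒edges< : ∀ {M u} → u ∈ M → ¬ InTriangle u M → Unique M → PathFree M → edges M < length M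
  pathFree⇒edges< {M} = strict (length M) ≤-refl

-- Numerical inequalities and the finite check for the K₄-free case.

4mn≤[m+n]² : ∀ m n → 4 * (m * n) ≤ (m + n) * (m + n)
4mn≤[m+n]² m n with ≤-total m n
... | inj₁ m≤n with k , refl ← m≤n⇒∃[o]m+o≡n m≤n = ≤-trans (m≤m+n _ (k * k)) (≤-reflexive (arith m k))
  where
  arith : ∀ m k → 4 * (m * (m + k)) + k * k ≡ (m + (m + k)) * (m + (m + k))
  arith = solve-∀
... | inj₂ n≤m with k , refl ← m≤n⇒∃[o]m+o≡n n≤m = ≤-trans (m≤m+n _ (k * k)) (≤-reflexive (arith n k))
  where
  arith : ∀ n k → 4 * ((n + k) * n) + k * k ≡ ((n + k) + n) * ((n + k) + n)
  arith = solve-∀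

∀Bool? : {P : Bool → Set} → U.Decidable P → Dec (∀ b → P b)
∀Bool? P? with P? true | P? false
... | yes t | yes f = yes λ { true → t ; false → f }
... | no ¬t | _     = no λ h → ¬t (h true)
... | yes _ | no ¬f = no λ h → ¬f (h false)

-- For a triangle abc: p stands for its private edges, x for the vertices joined to v by a private edge.
isolated : (xa xb xc pab pac pbc : Bool) → Bool
isolated xa xb xc pab pac pbc = not (xa ∧ xb ∧ pab) ∨ (not xc ∧ pac ∧ pbc)

-- Incidences of a private edge of abc with an endpoint that is not a private neighbour of v.
outer-weight : (xa xb xc pab pac pbc : Bool) → ℕ
outer-weight xa xb xc pab pac pbc =
  𝟙 pab * (𝟙 (not xa) + 𝟙 (not xb)) + 𝟙 pac * (𝟙 (not xa) + 𝟙 (not xc)) + 𝟙 pbc * (𝟙 (not xb) + 𝟙 (not xc))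

-- The first three hypotheses: of any two edges one is private. The last three: a private edge
-- between private neighbours of v has v as third vertex, whose edges to both ends are private.
OuterWeight≥2 : (xa xb xc pab pac pbc : Bool) → Set
OuterWeight≥2 xa xb xc pab pac pbc =
  pab ∨ pac ≡ true → pab ∨ pbc ≡ true → pac ∨ pbc ≡ true →
  isolated xa xb xc pab pac pbc ≡ true → isolated xa xc xb pac pab pbc ≡ true →
  isolated xb xc xa pbc pab pac ≡ true → 2 ≤ outer-weight xa xb xc pab pac pbc

outerWeight≥2? : ∀ xa xb xc pab pac pbc → Dec (OuterWeight≥2 xa xb xc pab pac pbc)
outerWeight≥2? xa xb xc pab pac pbc =
  (pab ∨ pac Bool.≟ true) →-dec (pab ∨ pbc Bool.≟ true) →-dec (pac ∨ pbc Bool.≟ true) →-dec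
  (isolated xa xb xc pab pac pbc Bool.≟ true) →-dec (isolated xa xc xb pac pab pbc Bool.≟ true) →-dec
  (isolated xb xc xa pbc pab pac Bool.≟ true) →-dec (2 ≤? outer-weight xa xb xc pab pac pbc)

-- If a private edge has both ends among the private neighbours of v, the other two edges each
-- contribute their end at the third vertex. Otherwise each of the at least two private edges has an
-- outer end. The 64 cases are checked by evaluation.
outer-weight≥2 : ∀ xa xb xc pab pac pbc → OuterWeight≥2 xa xb xc pab pac pbc
outer-weight≥2 = from-yes (∀Bool? λ xa → ∀Bool? λ xb → ∀Bool? λ xc → ∀Bool? λ pab → ∀Bool? λ pac → ∀Bool? λ pbc →
  outerWeight≥2? xa xb xc pab pac pbc)

-- One K₄ is removed from 8 + y vertices, another from the remaining 4 + y. At most (8 + y) + (4 +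
-- y) ∸ 4 = 8 + 2y triangles are lost, and 8(8 + 2y) + y² = (8 + y)² without slack.
pair-arith : ∀ t t₁ t₂ d₁ d₂ y → t + d₁ ≤ 4 + (4 + y) + t₁ → t₁ + d₂ ≤ 4 + y + t₂ → 4 ≤ d₁ + d₂ →
  8 * t₂ ≤ y * y → 8 * t ≤ (8 + y) * (8 + y)
pair-arith t t₁ t₂ d₁ d₂ y h₁ h₂ hd h = begin
  8 * t                                     ≤⟨ *-monoʳ-≤ 8 t≤ ⟩
  8 * (8 + 2 * y + t₂)                      ≡⟨ *-distribˡ-+ 8 (8 + 2 * y) t₂ ⟩
  8 * (8 + 2 * y) + 8 * t₂                  ≤⟨ +-monoʳ-≤ (8 * (8 + 2 * y)) h ⟩
  8 * (8 + 2 * y) + y * y                   ≡⟨ square y ⟩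
  (8 + y) * (8 + y)                         ∎
  where
  open ≤-Reasoning
  square : ∀ y → 8 * (8 + 2 * y) + y * y ≡ (8 + y) * (8 + y)
  square = solve-∀
  collect : ∀ y t₂ → 4 + (4 + y) + (4 + y + t₂) ≡ 4 + (8 + 2 * y + t₂)
  collect = solve-∀
  t≤ : t ≤ 8 + 2 * y + t₂
  t≤ = +-cancelˡ-≤ 4 t (8 + 2 * y + t₂) (begin
    4 + t                                   ≤⟨ +-monoˡ-≤ t hd ⟩
    d₁ + d₂ + t                             ≡⟨ trans (+-comm (d₁ + d₂) t) (sym (+-assoc t d₁ d₂)) ⟩
    t + d₁ + d₂                             ≤⟨ +-monoˡ-≤ d₂ h₁ ⟩
    4 + (4 + y) + t₁ + d₂                   ≡⟨ +-assoc (4 + (4 + y)) t₁ d₂ ⟩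
    4 + (4 + y) + (t₁ + d₂)                 ≤⟨ +-monoʳ-≤ (4 + (4 + y)) h₂ ⟩
    4 + (4 + y) + (4 + y + t₂)              ≡⟨ collect y t₂ ⟩
    4 + (8 + 2 * y + t₂)                    ∎)

-- Adding the three pairwise inequalities gives total defect at least 6. So at most 24 + 3y ∸ 6 = 18
-- + 3y triangles are lost, and 8(18 + 3y) + y² = (12 + y)².
triple-arith : ∀ t t₁ t₂ t₃ d₁ d₂ d₃ y →
  t + d₁ ≤ 4 + (8 + y) + t₁ → t₁ + d₂ ≤ 4 + (4 + y) + t₂ → t₂ + d₃ ≤ 4 + y + t₃ →
  4 ≤ d₁ + d₂ → 4 ≤ d₂ + d₃ → 4 ≤ d₁ + d₃ → 8 * t₃ ≤ y * y → 8 * t ≤ (12 + y) * (12 + y)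
triple-arith t t₁ t₂ t₃ d₁ d₂ d₃ y h₁ h₂ h₃ d₁₂ d₂₃ d₁₃ h = begin
  8 * t                                     ≤⟨ *-monoʳ-≤ 8 t≤ ⟩
  8 * (18 + 3 * y + t₃)                     ≡⟨ *-distribˡ-+ 8 (18 + 3 * y) t₃ ⟩
  8 * (18 + 3 * y) + 8 * t₃                 ≤⟨ +-monoʳ-≤ (8 * (18 + 3 * y)) h ⟩
  8 * (18 + 3 * y) + y * y                  ≡⟨ square y ⟩
  (12 + y) * (12 + y)                       ∎
  where
  open ≤-Reasoning
  square : ∀ y → 8 * (18 + 3 * y) + y * y ≡ (12 + y) * (12 + y)
  square = solve-∀
  double : ∀ a b c → (a + b) + (b + c) + (a + c) ≡ 2 * (a + b + c)
  double = solve-∀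
  gather : ∀ a b c d → a + b + c + d ≡ d + a + b + c
  gather = solve-∀
  collect : ∀ y t → 4 + (8 + y) + (4 + (4 + y) + (4 + y + t)) ≡ 6 + (18 + 3 * y + t)
  collect = solve-∀
  6≤d : 6 ≤ d₁ + d₂ + d₃
  6≤d = *-cancelˡ-≤ 2 (≤-trans (+-mono-≤ (+-mono-≤ d₁₂ d₂₃) d₁₃) (≤-reflexive (double d₁ d₂ d₃)))
  t≤ : t ≤ 18 + 3 * y + t₃
  t≤ = +-cancelˡ-≤ 6 t (18 + 3 * y + t₃) (begin
    6 + t                                             ≤⟨ +-monoˡ-≤ t 6≤d ⟩
    d₁ + d₂ + d₃ + t                                  ≡⟨ gather d₁ d₂ d₃ t ⟩
    t + d₁ + d₂ + d₃                                  ≤⟨ +-monoˡ-≤ d₃ (+-monoˡ-≤ d₂ h₁) ⟩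
    4 + (8 + y) + t₁ + d₂ + d₃                        ≡⟨ cong (_+ d₃) (+-assoc (4 + (8 + y)) t₁ d₂) ⟩
    4 + (8 + y) + (t₁ + d₂) + d₃                      ≤⟨ +-monoˡ-≤ d₃ (+-monoʳ-≤ (4 + (8 + y)) h₂) ⟩
    4 + (8 + y) + (4 + (4 + y) + t₂) + d₃             ≡⟨ trans (+-assoc (4 + (8 + y)) (4 + (4 + y) + t₂) d₃) (cong (4 + (8 + y) +_) (+-assoc (4 + (4 + y)) t₂ d₃)) ⟩
    4 + (8 + y) + (4 + (4 + y) + (t₂ + d₃))           ≤⟨ +-monoʳ-≤ (4 + (8 + y)) (+-monoʳ-≤ (4 + (4 + y)) h₃) ⟩
    4 + (8 + y) + (4 + (4 + y) + (4 + y + t₃))        ≡⟨ collect y t₃ ⟩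
    6 + (18 + 3 * y + t₃)                             ∎)

defect-arith : ∀ t d x t′ → t + d ≤ 4 + x + t′ → 2 ≤ d → 8 * t′ ≤ x * x → 8 * t ≤ (4 + x) * (4 + x)
defect-arith t d x t′ h 2≤d h′ = begin
  8 * t                    ≤⟨ *-monoʳ-≤ 8 (+-cancelˡ-≤ 2 t (2 + x + t′) (≤-trans (+-monoˡ-≤ t 2≤d) (≤-trans (≤-reflexive (+-comm d t)) h))) ⟩
  8 * (2 + x + t′)         ≡⟨ *-distribˡ-+ 8 (2 + x) t′ ⟩
  8 * (2 + x) + 8 * t′     ≤⟨ +-monoʳ-≤ (8 * (2 + x)) h′ ⟩
  8 * (2 + x) + x * x      ≡⟨ square x ⟩
  (4 + x) * (4 + x)        ∎
  where
  open ≤-Reasoning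
  square : ∀ x → 8 * (2 + x) + x * x ≡ (4 + x) * (4 + x)
  square = solve-∀

-- The four lost triangles cost 32 = 4 + 4 · 7, at most the growth 4 + 4n of the square.
delete-two-arith : ∀ t t′ n → t ≤ 4 + t′ → 7 ≤ n → 8 * t′ ≤ n * n → 8 * t ≤ (2 + n) * (2 + n)
delete-two-arith t t′ n h 7≤n h′ = begin
  8 * t                    ≤⟨ *-monoʳ-≤ 8 h ⟩
  8 * (4 + t′)             ≡⟨ *-distribˡ-+ 8 4 t′ ⟩
  4 + 4 * 7 + 8 * t′       ≤⟨ +-mono-≤ (+-monoʳ-≤ 4 (*-monoʳ-≤ 4 7≤n)) h′ ⟩
  4 + 4 * n + n * n        ≡⟨ square n ⟩
  (2 + n) * (2 + n)        ∎
  where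
  open ≤-Reasoning
  square : ∀ n → 4 + 4 * n + n * n ≡ (2 + n) * (2 + n)
  square = solve-∀

-- For w = 1 both p and q vanish and 8 · 8 = 8²; for w = 2 both are at most 1 and 8 · 10 = 80 < 9².
few-outside-arith : ∀ w t p q → 1 ≤ w → w ≤ 2 → t ≤ 8 + (p + q) → 2 * p ≤ w → 2 * q ≤ w →
  8 * t ≤ (7 + w) * (7 + w)
few-outside-arith 1 t p q _ _ h hp hq = *-monoʳ-≤ 8 (≤-trans h (+-monoʳ-≤ 8 {p + q} {0} (+-mono-≤ (half p hp) (half q hq))))
  where
  half : ∀ p → 2 * p ≤ 1 → p ≤ 0
  half zero    _ = z≤n
  half (suc p) h = ⊥-elim (<⇒≱ (*-monoʳ-≤ 2 (s≤s (z≤n {p}))) h)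
few-outside-arith 2 t p q _ _ h hp hq =
  ≤-trans (*-monoʳ-≤ 8 {t} {10} (≤-trans h (+-monoʳ-≤ 8 {p + q} {2} (+-mono-≤ {p} {1} (*-cancelˡ-≤ 2 hp) (*-cancelˡ-≤ 2 hq))))) (n≤1+n 80)
few-outside-arith (suc (suc (suc _))) t p q _ (s≤s (s≤s ()))

-- Bounds without a suspended P₄, beginning with the K₄-free case by private edges.

module Suspension {V : Set} {_~_ : Rel V 0ℓ} (_~?_ : Decidable _~_)
  (~-sym : Symmetric _~_) (~-irrefl : ∀ {x} → ¬ x ~ x) (_≟_ : DecidableEquality V)
  (no-P̂₄ : ∀ {v a b c d} → v ~ a → v ~ b → v ~ c → v ~ d →
           a ~ b → b ~ c → c ~ d → a ≢ c → b ≢ d → a ≢ d → ⊥) where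

  open Links _~?_ ~-sym ~-irrefl public

  K₄Free : List V → Set
  K₄Free L = ∀ {a b c d} → a ∈ L → b ∈ L → c ∈ L → d ∈ L →
    a ~ b → a ~ c → a ~ d → b ~ c → b ~ d → c ~ d → ⊥

  module PrivateEdges (L : List V) (uq : Unique L) (k₄-free : K₄Free L) where

    -- abstract, so that goals mention the decision itself and can be abstracted over it
    abstract
      common? : ∀ u w z → Dec (u ~ z × w ~ z)
      common? u w z = (u ~? z) ×-dec (w ~? z)

    Common : V → V → List V
    Common u w = filter (common? u w) L

    Common⁺ : ∀ {u w z} → z ∈ L → u ~ z → w ~ z → z ∈ Common u w
    Common⁺ {u} {w} z∈ u~z w~z = ∈-filter⁺ (common? u w) z∈ (u~z , w~z)

    Common-sym : ∀ u w → length (Common u w) ≡ length (Common w u)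
    Common-sym u w = trans (sym (∑-𝟙 (common? u w) L))
      (trans (∑-cong L λ {z} _ → cong 𝟙 (common-swap z)) (∑-𝟙 (common? w u) L))
      where
      common-swap : ∀ z → does (common? u w z) ≡ does (common? w u z)
      common-swap z with common? u w z | common? w u z
      ... | yes _ | yes _ = refl
      ... | no _  | no _  = refl
      ... | yes (p , q) | no ¬qp = ⊥-elim (¬qp (q , p))
      ... | no ¬pq | yes (q , p) = ⊥-elim (¬pq (p , q))

    -- Edges in no triangle are excluded, so that a private edge determines its third vertex.
    Private : V → V → Set
    Private u w = u ~ w × length (Common u w) ≡ 1

    abstract
      private? : ∀ u w → Dec (Private u w)
      private? u w = (u ~? w) ×-dec (length (Common u w) ℕ.≟ 1)

    Private-sym : ∀ {u w} → Private u w → Private w u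
    Private-sym {u} {w} (u~w , e) = ~-sym u~w , trans (Common-sym w u) e

    d : V → ℕ
    d u = length (filter (private? u) L)

    third-vertex : ∀ {u w x y} → Private u w → x ∈ L → u ~ x → w ~ x → y ∈ L → u ~ y → w ~ y → x ≡ y
    third-vertex (_ , e) x u~x w~x y u~y w~y =
      ≤1-equal (≤-reflexive e) (Common⁺ x u~x w~x) (Common⁺ y u~y w~y)

    -- If neither edge is private, a and b have a common neighbour x other than c, and a and c have
    -- one, y, other than b. If x is y, then a b c x is a K₄; otherwise x b c y is a path in the
    -- link of a.
    private-or : ∀ {a b c} → a ∈ L → b ∈ L → c ∈ L → a ~ b → a ~ c → b ~ c →
      does (private? a b) ∨ does (private? a c) ≡ true
    private-or {a} {b} {c} a∈ b∈ c∈ a~b a~c b~c with private? a b | private? a c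
    ... | yes _ | _     = refl
    ... | no _  | yes _ = refl
    ... | no ¬ab | no ¬ac
      with x , x∈ , x≢c ← second-member (Unique.filter⁺ (common? a b) uq) (Common⁺ c∈ a~c b~c) (λ e → ¬ab (a~b , e))
         | y , y∈ , y≢b ← second-member (Unique.filter⁺ (common? a c) uq) (Common⁺ b∈ a~b (~-sym b~c)) (λ e → ¬ac (a~c , e))
      with x∈L , a~x , b~x ← ∈-filter⁻ (common? a b) {xs = L} x∈
         | y∈L , a~y , c~y ← ∈-filter⁻ (common? a c) {xs = L} y∈
      with x ≟ y
    ... | yes refl = ⊥-elim (k₄-free a∈ b∈ c∈ x∈L a~b a~c a~x b~c b~x c~y)
    ... | no x≢y   = ⊥-elim (no-P̂₄ a~x a~b a~c a~y (~-sym b~x) b~c c~y x≢c (y≢b ∘ sym) x≢y)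

    module _ {v : V} (v∈ : v ∈ L) where

      -- If a and b are private neighbours of v, then v is a common neighbour of them; privacy of ab
      -- forces c to be v.
      isolated-or : ∀ {a b c} → a ∈ L → b ∈ L → c ∈ L → a ~ b → a ~ c → b ~ c →
        isolated (does (private? v a)) (does (private? v b)) (does (private? v c))
          (does (private? a b)) (does (private? a c)) (does (private? b c)) ≡ true
      isolated-or {a} {b} {c} a∈ b∈ c∈ a~b a~c b~c with private? v a | private? v b | private? a b
      ... | no _  | _     | _     = refl
      ... | yes _ | no _  | _     = refl
      ... | yes _ | yes _ | no _  = refl
      ... | yes va | yes vb | yes ab
        with refl ← third-vertex ab v∈ (~-sym (proj₁ va)) (~-sym (proj₁ vb)) c∈ a~c b~c
        with private? v v | private? a v | private? b v
      ... | yes (v~v , _) | _ | _ = ⊥-elim (~-irrefl v~v)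
      ... | no _ | no ¬av | _ = ⊥-elim (¬av (Private-sym va))
      ... | no _ | yes _ | no ¬bv = ⊥-elim (¬bv (Private-sym vb))
      ... | no _ | yes _ | yes _ = refl

      -- A private edge lies in exactly one triangle, so summing g over all triples counts the pairs (a , ab)
      -- with ab private and a not a private neighbour of v.
      g : V → V → V → ℕ
      g a b c = 𝟙 (not (does (private? v a))) * (𝟙 (does (private? a b)) * 𝟙 (does (common? a b c)))

      g-triangle : ∀ {a b c} → a ~ c → b ~ c →
        g a b c ≡ 𝟙 (not (does (private? v a))) * 𝟙 (does (private? a b))
      g-triangle {a} {b} {c} a~c b~c with common? a b c
      ... | yes _ = cong (𝟙 (not (does (private? v a))) *_) (*-identityʳ (𝟙 (does (private? a b))))
      ... | no ¬p = ⊥-elim (¬p (a~c , b~c))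

      private-sym : ∀ a b → does (private? a b) ≡ does (private? b a)
      private-sym a b with private? a b | private? b a
      ... | yes _ | yes _ = refl
      ... | no _  | no _  = refl
      ... | yes p | no ¬q = ⊥-elim (¬q (Private-sym p))
      ... | no ¬p | yes q = ⊥-elim (¬p (Private-sym q))

      -- Over the six orders of a triangle `g` takes each incidence of an edge with an endpoint
      -- once, so the sum is `outer-weight`.
      g-permutations : ∀ {a b c} → a ∈ L → b ∈ L → c ∈ L → a ~ b → a ~ c → b ~ c →
        2 ≤ (g a b c + g b a c + g b c a) + (g a c b + g c a b + g c b a)
      g-permutations {a} {b} {c} a∈ b∈ c∈ a~b a~c b~c
        rewrite g-triangle a~c b~c | g-triangle b~c a~c | g-triangle (~-sym a~b) (~-sym a~c)
              | g-triangle a~b (~-sym b~c) | g-triangle (~-sym b~c) a~b | g-triangle (~-sym a~c) (~-sym a~b)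
              | private-sym b a | private-sym c a | private-sym c b
        = ≤-trans
            (outer-weight≥2 xa xb xc pab pac pbc
              (private-or a∈ b∈ c∈ a~b a~c b~c)
              (subst (λ p → p ∨ pbc ≡ true) (private-sym b a) (private-or b∈ a∈ c∈ (~-sym a~b) b~c a~c))
              (subst₂ (λ p q → p ∨ q ≡ true) (private-sym c a) (private-sym c b)
                (private-or c∈ a∈ b∈ (~-sym a~c) (~-sym b~c) a~b))
              (isolated-or a∈ b∈ c∈ a~b a~c b~c)
              (subst (λ p → isolated xa xc xb pac pab p ≡ true) (private-sym c b)
                (isolated-or a∈ c∈ b∈ a~c a~b (~-sym b~c)))
              (subst₂ (λ p q → isolated xb xc xa pbc p q ≡ true) (private-sym b a) (private-sym c a)
                (isolated-or b∈ c∈ a∈ b~c (~-sym a~b) (~-sym a~c))))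
            (≤-reflexive (arith (𝟙 pab) (𝟙 pac) (𝟙 pbc) (𝟙 (not xa)) (𝟙 (not xb)) (𝟙 (not xc))))
        where
        pab = does (private? a b)
        pac = does (private? a c)
        pbc = does (private? b c)
        xa = does (private? v a)
        xb = does (private? v b)
        xc = does (private? v c)
        arith : ∀ p q r x y z → p * (x + y) + q * (x + z) + r * (y + z)
          ≡ (x * p + y * p + y * r) + (x * q + z * q + z * r)
        arith = solve-∀

      private-codegree : ∀ a b → 𝟙 (does (private? a b)) * length (Common a b) ≡ 𝟙 (does (private? a b))
      private-codegree a b with private? a b
      ... | yes (_ , e) rewrite e = refl
      ... | no _ = refl

      -- Summation over c comes first: a private edge has exactly one common neighbour, so what
      -- remains is the indicator of privacy.
      ∑g : ∑³ L g ≡ ∑ L λ a → 𝟙 (not (does (private? v a))) * d a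
      ∑g = ∑-cong L λ {a} _ → trans (∑-cong L λ {b} _ → begin
          ∑ L (λ c → g a b c)
            ≡⟨ ∑-* L (out a) (λ c → 𝟙 (does (private? a b)) * 𝟙 (does (common? a b c))) ⟩
          out a * ∑ L (λ c → 𝟙 (does (private? a b)) * 𝟙 (does (common? a b c)))
            ≡⟨ cong (out a *_) (trans (∑-* L (𝟙 (does (private? a b))) (λ c → 𝟙 (does (common? a b c)))) (cong (𝟙 (does (private? a b)) *_) (∑-𝟙 (common? a b) L))) ⟩
          out a * (𝟙 (does (private? a b)) * length (Common a b))
            ≡⟨ cong (out a *_) (private-codegree a b) ⟩
          out a * 𝟙 (does (private? a b)) ∎)
        (trans (∑-* L (out a) (λ b → 𝟙 (does (private? a b)))) (cong (out a *_) (∑-𝟙 (private? a) L)))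
        where
        open ≡-Reasoning
        out : V → ℕ
        out a = 𝟙 (not (does (private? v a)))

      out-count : ∑ L (λ a → 𝟙 (not (does (private? v a)))) + d v ≡ length L
      out-count = begin
        ∑ L (λ a → 𝟙 (not (does (private? v a)))) + d v
          ≡⟨ cong (∑ L (λ a → 𝟙 (not (does (private? v a)))) +_) (∑-𝟙 (private? v) L) ⟨
        ∑ L (λ a → 𝟙 (not (does (private? v a)))) + ∑ L (λ a → 𝟙 (does (private? v a)))
          ≡⟨ ∑-+ L _ _ ⟨
        ∑ L (λ a → 𝟙 (not (does (private? v a))) + 𝟙 (does (private? v a)))
          ≡⟨ ∑-cong L (λ {a} _ → one (does (private? v a))) ⟩
        ∑ L (λ _ → 1)
          ≡⟨ trans (∑-const L 1) (*-identityʳ (length L)) ⟩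
        length L ∎
        where
        open ≡-Reasoning
        one : ∀ b → 𝟙 (not b) + 𝟙 b ≡ 1
        one true  = refl
        one false = refl

  k₄Free⇒8tri≤n² : ∀ L → Unique L → K₄Free L → 8 * tri L ≤ length L * length L
  k₄Free⇒8tri≤n² []        uq kf = z≤n
  k₄Free⇒8tri≤n² L@(x ∷ K) uq kf = go (maximum d x K)
    where
    open PrivateEdges L uq kf
    open ≤-Reasoning
    go : (∃ λ v → v ∈ L × (∀ {u} → u ∈ L → d u ≤ d v)) → 8 * tri L ≤ length L * length L
    go (v , v∈ , max) = begin
      8 * tri L                          ≡⟨ *-assoc 4 2 (tri L) ⟩
      4 * (2 * tri L)                    ≤⟨ *-monoʳ-≤ 4 (2tri≤∑ (g v∈) L (g-permutations v∈)) ⟩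
      4 * ∑³ L (g v∈)                    ≡⟨ cong (4 *_) (∑g v∈) ⟩
      -- By maximality `d a` is at most `d v`, so twice the number of triangles is at most the size
      -- of the private neighbourhood of v times the number of vertices outside it.
      4 * ∑ L (λ a → out a * d a)        ≤⟨ *-monoʳ-≤ 4 (∑-mono L λ {a} a∈ → ≤-trans (*-monoʳ-≤ (out a) (max a∈)) (≤-reflexive (*-comm (out a) (d v)))) ⟩
      4 * ∑ L (λ a → d v * out a)        ≡⟨ cong (4 *_) (trans (∑-* L (d v) out) (*-comm (d v) (∑ L out))) ⟩
      4 * (∑ L out * d v)                ≤⟨ 4mn≤[m+n]² (∑ L out) (d v) ⟩
      (∑ L out + d v) * (∑ L out + d v)  ≡⟨ cong₂ _*_ (out-count v∈) (out-count v∈) ⟩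
      length L * length L                ∎
      where
      out : V → ℕ
      out a = 𝟙 (not (does (private? v a)))

  -- a record, so that with-abstraction does not unfold tri on explicit lists
  record Bound (L : List V) : Set where
    constructor bound
    field 8tri≤n² : 8 * tri L ≤ length L * length L
  open Bound public

  k₄Free⇒bound : ∀ L → Unique L → K₄Free L → Bound L
  k₄Free⇒bound L uq free = bound (k₄Free⇒8tri≤n² L uq free)

  -- K₄s, their defect, and the triangles lost by deleting one.

  Clique K₄ : List V → Set
  Clique S = AllPairs _~_ S
  K₄ S = Clique S × length S ≡ 4

  Clique-↭ : ∀ {S T} → S ↭ T → Clique S → Clique T
  Clique-↭ p = PermS.AllPairs-resp-↭ (setoid V) ~-sym ((λ { refl r → r }) , (λ { refl r → r })) (↭⇒↭ₛ p)

  Clique-unique : ∀ {S} → Clique S → Unique S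
  Clique-unique = AllPairs.map ~⇒≢

  SeparatedFrom : V → List V → Set
  SeparatedFrom x S = ∀ {u v} → u ∈ S → v ∈ S → u ≢ v → x ~ u → x ~ v → ⊥

  -- Two neighbours u and v of x in the K₄ u v s t put the path x v s t into the link of u.
  K₄-separated : ∀ {S x} → K₄ S → x ∉ S → SeparatedFrom x S
  K₄-separated {S} {x} (cl , len) x∉S u∈ v∈ u≢v x~u x~v
    with S′ , p ← ∈⇒↭ u∈
    with S″ , q ← ∈⇒↭ (∈-∷⁻ (∈-resp-↭ p v∈) (u≢v ∘ sym))
    = go S″ (trans (sym (↭-length r)) len) (Clique-↭ r cl) (x∉S ∘ ∈-resp-↭ (↭-sym r))
    where
    r = ↭-trans p (prep _ q)
    go : ∀ S″ → suc (suc (length S″)) ≡ 4 → Clique (_ ∷ _ ∷ S″) → x ∉ _ ∷ _ ∷ S″ → ⊥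
    go (s ∷ t ∷ []) refl ((u~v ∷ u~s ∷ u~t ∷ []) ∷ (v~s ∷ v~t ∷ []) ∷ (s~t ∷ []) ∷ [] ∷ []) x∉ =
      no-P̂₄ (~-sym x~u) u~v u~s u~t x~v v~s s~t
        (λ { refl → x∉ (there (there (here refl))) }) (~⇒≢ v~t) (λ { refl → x∉ (there (there (there (here refl)))) })

  separated⇒|N|≤1 : ∀ {S x} → Unique S → SeparatedFrom x S → length (N x S) ≤ 1
  separated⇒|N|≤1 {S} {x} uq sep = all-equal-≤1 (N-unique x uq) λ {u} {v} u∈ v∈ → eq u v (N⁻ S u∈) (N⁻ S v∈)
    where
    eq : ∀ u v → u ∈ S × x ~ u → v ∈ S × x ~ v → u ≡ v
    eq u v (u∈ , x~u) (v∈ , x~v) with u ≟ v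
    ... | yes e  = e
    ... | no u≢v = ⊥-elim (sep u∈ v∈ u≢v x~u x~v)

  -- No triangle has two vertices in S and one in X, and those with just the vertex u in S are the
  -- edges of the link of u in X.
  tri-++ : ∀ S X → Clique S → (∀ {x} → x ∈ X → SeparatedFrom x S) →
    tri (S ++ X) ≡ tri S + ∑ S (λ u → edges (N u X)) + tri X
  tri-++ []      X cl sep = refl
  tri-++ (u ∷ S) X (u~S ∷ cl) sep
    rewrite N-++ u S X
          | edges-++ (N u S) (N u X) (λ {y} {x} y∈ x∈ y~x →
              let y∈S , u~y = N⁻ {u} {y} S y∈ ; x∈X , u~x = N⁻ {u} {x} X x∈
              in sep x∈X (here refl) (there y∈S) (~⇒≢ u~y) (~-sym u~x) (~-sym y~x))
          | tri-++ S X cl (λ x∈ u∈ v∈ → sep x∈ (there u∈) (there v∈))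
    = arith (edges (N u S)) (edges (N u X)) (tri S) (∑ S λ u → edges (N u X)) (tri X)
    where
    arith : ∀ a b c d e → a + b + (c + d + e) ≡ a + c + (b + d) + e
    arith = solve-∀

  -- For a P₄-free link this is the number of star components: a triangle contributes 0, a star 1.
  -- Such a link has at most as many edges as vertices, so the subtraction is exact.
  deficit : V → List V → ℕ
  deficit v X = length (N v X) ∸ edges (N v X)

  -- The second sum counts the vertices of X without a neighbour in S.
  defect : List V → List V → ℕ
  defect S X = ∑ S (λ v → deficit v X) + ∑ X (λ x → 1 ∸ length (N x S))

  N-pathFree : ∀ v X → PathFree (N v X)
  N-pathFree v X a∈ b∈ c∈ d∈ =
    no-P̂₄ (proj₂ (N⁻ X a∈)) (proj₂ (N⁻ X b∈)) (proj₂ (N⁻ X c∈)) (proj₂ (N⁻ X d∈))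

  deficit≥1 : ∀ {v X u} → Unique X → u ∈ X → v ~ u → ¬ InTriangle u (N v X) → 1 ≤ deficit v X
  deficit≥1 {v} {X} uq u∈ v~u ¬t =
    m<n⇒0<n∸m (pathFree⇒edges< (N⁺ u∈ v~u) ¬t (N-unique v uq) (N-pathFree v X))

  edges+deficit : ∀ {v X} → Unique X → edges (N v X) + deficit v X ≡ length (N v X)
  edges+deficit {v} {X} uq = m+[n∸m]≡n (pathFree⇒edges≤ (N v X) (N-unique v uq) (N-pathFree v X))

  degree-swap : ∀ S X → ∑ S (λ v → length (N v X)) ≡ ∑ X (λ x → length (N x S))
  degree-swap S X = trans (∑-cong S λ {v} _ → sym (*-identityˡ (length (N v X))))
    (trans (∑-degree-swap ~-sym S X (λ _ → 1))
      (∑-cong X λ {x} _ → trans (∑-const (N x S) 1) (*-identityʳ (length (N x S)))))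

  outside : ∀ S {X : List V} {x} → Unique (S ++ X) → x ∈ X → x ∉ S
  outside S uq x∈X x∈S = Unique-disjoint S uq x∈S x∈X

  -- The lost triangles are at most four inside S, and the edges of the links in X. Edges and
  -- deficits add up to the degrees into X; together with the vertices not adjacent to S these make
  -- |X|, since a vertex of X has at most one neighbour in S.
  tri+defect≤ : ∀ S X → K₄ S → Unique (S ++ X) → tri (S ++ X) + defect S X ≤ 4 + length X + tri X
  tri+defect≤ S X k@(cl , len) uq = begin
    tri (S ++ X) + defect S X
      ≡⟨ cong (_+ defect S X) (tri-++ S X cl sep) ⟩
    tri S + E + tri X + (F + I)
      ≡⟨ arith (tri S) E (tri X) F I ⟩
    tri S + (E + F + I) + tri X
      ≤⟨ +-monoˡ-≤ (tri X) (+-mono-≤ tri≤4 count) ⟩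
    4 + length X + tri X ∎
    where
    open ≤-Reasoning
    E = ∑ S λ v → edges (N v X)
    F = ∑ S λ v → deficit v X
    I = ∑ X λ x → 1 ∸ length (N x S)
    arith : ∀ a b c d e → a + b + c + (d + e) ≡ a + (b + d + e) + c
    arith = solve-∀
    sep : ∀ {x} → x ∈ X → SeparatedFrom x S
    sep x∈ = K₄-separated k (outside S uq x∈)
    tri≤4 : tri S ≤ 4
    tri≤4 = ≤-trans (tri≤choose₃ S) (≤-reflexive (cong choose₃ len))
    count : E + F + I ≤ length X
    count = begin
      E + F + I
        ≡⟨ cong (_+ I) (∑-+ S _ _) ⟨
      ∑ S (λ v → edges (N v X) + deficit v X) + I
        ≡⟨ cong (_+ I) (trans (∑-cong S λ _ → edges+deficit (Unique-++ʳ S uq)) (degree-swap S X)) ⟩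
      ∑ X (λ x → length (N x S)) + I
        ≡⟨ ∑-+ X _ _ ⟨
      ∑ X (λ x → length (N x S) + (1 ∸ length (N x S)))
        ≤⟨ ∑-mono X (λ x∈ → ≤-reflexive (m+[n∸m]≡n (separated⇒|N|≤1 (Clique-unique cl) (sep x∈)))) ⟩
      ∑ X (λ _ → 1)
        ≡⟨ trans (∑-const X 1) (*-identityʳ (length X)) ⟩
      length X ∎

  -- A vertex u of Q not adjacent to S is counted in defect S X. Otherwise u is adjacent to one v in S;
  -- if its component in the link of v is not a triangle then it is counted in defect S X, and if it is
  -- a triangle uab then the component of a or b in the link of u outside S ∪ Q is counted in defect Q Y.
  defect+defect≥4 : ∀ {S Q Z X Y} → K₄ S → K₄ Q → X ↭ Q ++ Z ++ Y → Unique (S ++ X) →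
    (∀ {u a b} → u ∈ Q → a ∈ Z → b ∈ Z → u ~ a → u ~ b → a ~ b → ⊥) → 4 ≤ defect S X + defect Q Y
  defect+defect≥4 {S} {Q} {Z} {X} {Y} kS@(clS , _) kQ@(clQ , lenQ) X↭ uq Z-ok = begin
    4                                                             ≡⟨ trans (∑-const Q 1) (trans (*-identityʳ (length Q)) lenQ) ⟨
    ∑ Q (λ _ → 1)                                                 ≤⟨ ∑-mono Q token ⟩
    ∑ Q (λ u → (∑ (N u S) f + i u) + deficit u Y)                     ≡⟨ trans (∑-+ Q _ _) (cong (_+ ∑ Q (λ u → deficit u Y)) (∑-+ Q _ _)) ⟩
    ∑ Q (λ u → ∑ (N u S) f) + ∑ Q i + ∑ Q (λ u → deficit u Y)         ≤⟨ +-monoˡ-≤ (∑ Q (λ u → deficit u Y)) (+-mono-≤ via-S via-X) ⟩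
    defect S X + ∑ Q (λ u → deficit u Y)                                   ≤⟨ +-monoʳ-≤ (defect S X) (m≤m+n _ _) ⟩
    defect S X + defect Q Y                                                 ∎
    where
    open ≤-Reasoning
    f i : V → ℕ
    f v = deficit v X
    i x = 1 ∸ length (N x S)
    uqX = Unique-++ʳ S uq
    uqQZY = Unique-↭ X↭ uqX
    Q⊆X : ∀ {x} → x ∈ Q → x ∈ X
    Q⊆X x∈ = ∈-resp-↭ (↭-sym X↭) (∈-++⁺ˡ x∈)
    Y⊆X : ∀ {x} → x ∈ Y → x ∈ X
    Y⊆X x∈ = ∈-resp-↭ (↭-sym X↭) (∈-++⁺ʳ Q (∈-++⁺ʳ Z x∈))
    uqY : Unique Y
    uqY = Unique-++ʳ Z (Unique-++ʳ Q uqQZY)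
    S-sep : ∀ {v} → v ∈ S → SeparatedFrom v Q
    S-sep v∈ = K₄-separated kQ (λ v∈Q → Unique-disjoint S uq v∈ (Q⊆X v∈Q))
    -- A vertex v of S has at most one neighbour in Q, so its deficit is charged at most once.
    via-S : ∑ Q (λ u → ∑ (N u S) f) ≤ ∑ S f
    via-S = begin
      ∑ Q (λ u → ∑ (N u S) f)             ≡⟨ ∑-degree-swap ~-sym S Q f ⟨
      ∑ S (λ v → f v * length (N v Q))    ≤⟨ ∑-mono S (λ {v} v∈ → ≤-trans
                                               (*-monoʳ-≤ (f v) (separated⇒|N|≤1 (Clique-unique clQ) (S-sep v∈)))
                                               (≤-reflexive (*-identityʳ (f v)))) ⟩
      ∑ S f                               ∎
    via-X : ∑ Q i ≤ ∑ X i
    via-X = begin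
      ∑ Q i                ≤⟨ m≤m+n _ _ ⟩
      ∑ Q i + ∑ (Z ++ Y) i ≡⟨ ∑-++ Q (Z ++ Y) i ⟨
      ∑ (Q ++ Z ++ Y) i    ≡⟨ ∑-↭ i X↭ ⟨
      ∑ X i                ∎
    -- In the link of u, the only possible neighbour of a in Y is b: another one, c, would be
    -- adjacent to both u and a in the K₄ v u a b. Hence a lies in no triangle there.
    lone : ∀ {v u a b} → v ∈ S → v ~ u → v ~ a → v ~ b → u ~ a → u ~ b → a ~ b → a ∈ Y → 1 ≤ deficit u Y
    lone {v} {u} {a} {b} v∈ v~u v~a v~b u~a u~b a~b a∈Y = deficit≥1 uqY a∈Y u~a λ
      { (c , e , (c∈ , e∈) , (a~c , a~e , c~e)) → ~⇒≢ c~e (trans (is-b c∈ a~c) (sym (is-b e∈ a~e))) }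
      where
      T = v ∷ u ∷ a ∷ b ∷ []
      kT : K₄ T
      kT = ((v~u ∷ v~a ∷ v~b ∷ []) ∷ (u~a ∷ u~b ∷ []) ∷ (a~b ∷ []) ∷ [] ∷ []) , refl
      is-b : ∀ {c} → c ∈ N u Y → a ~ c → c ≡ b
      is-b {c} c∈ a~c with c ≟ b | N⁻ {u} {c} Y c∈
      ... | yes c≡b | _ = c≡b
      ... | no c≢b | c∈Y , u~c = ⊥-elim (K₄-separated kT c∉T (there (here refl)) (there (there (here refl)))
                                   (~⇒≢ u~a) (~-sym u~c) (~-sym a~c))
        where
        c∉T : c ∉ T
        c∉T (here refl) = Unique-disjoint S uq v∈ (Y⊆X c∈Y)
        c∉T (there (here refl)) = ~-irrefl u~c
        c∉T (there (there (here refl))) = ~-irrefl a~c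
        c∉T (there (there (there (here refl)))) = c≢b refl
    token : ∀ {u} → u ∈ Q → 1 ≤ ∑ (N u S) f + i u + deficit u Y
    token {u} u∈ with N u S in eq
    ... | [] = s≤s z≤n
    ... | v ∷ vs with N⁻ {u} {v} S (subst (v ∈_) (sym eq) (here refl))
    ... | v∈ , u~v with inTriangle? u (N v X)
    ... | no ¬t = m≤n⇒m≤n+o (deficit u Y) (m≤n⇒m≤n+o (1 ∸ suc (length vs)) (m≤n⇒m≤n+o (∑ vs f) (deficit≥1 uqX (Q⊆X u∈) (~-sym u~v) ¬t)))
    ... | yes (a , b , (a∈ , b∈) , (u~a , u~b , a~b)) =
      m≤n⇒m≤o+n (∑ (v ∷ vs) f + (1 ∸ suc (length vs))) (place (where? a∈ u~a) (where? b∈ u~b))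
      where
      v~_ : ∀ {c} → c ∈ N v X → v ~ c
      v~ c∈ = proj₂ (N⁻ X c∈)
      -- A vertex c of the triangle is not in Q, because v already has its one neighbour u there.
      where? : ∀ {c} → c ∈ N v X → u ~ c → c ∈ Z ⊎ c ∈ Y
      where? {c} c∈ u~c with ∈-++⁻ Q (∈-resp-↭ X↭ (proj₁ (N⁻ {v} {c} X c∈)))
      ... | inj₁ c∈Q = ⊥-elim (S-sep v∈ u∈ c∈Q (~⇒≢ u~c) (~-sym u~v) (v~ c∈))
      ... | inj₂ c∈  = ∈-++⁻ Z c∈
      -- `Z-ok` keeps a and b from both lying in Z, so one of them is in Y and bears the charge.
      place : a ∈ Z ⊎ a ∈ Y → b ∈ Z ⊎ b ∈ Y → 1 ≤ deficit u Y
      place (inj₁ a∈Z) (inj₁ b∈Z) = ⊥-elim (Z-ok u∈ a∈Z b∈Z u~a u~b a~b)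
      place (inj₂ a∈Y) _ = lone v∈ (~-sym u~v) (v~ a∈) (v~ b∈) u~a u~b a~b a∈Y
      place _ (inj₂ b∈Y) = lone v∈ (~-sym u~v) (v~ b∈) (v~ a∈) u~b u~a (~-sym a~b) b∈Y

  -- Splitting off K₄s; two or more disjoint K₄s.

  extract : ∀ (S : List V) {L} → Unique S → (∀ {x} → x ∈ S → x ∈ L) → ∃ λ X → L ↭ S ++ X
  extract []      {L} uq S⊆L = L , refl
  extract (x ∷ S) (x∉S ∷ uq) S⊆L with ∈⇒↭ (S⊆L (here refl))
  ... | L′ , p with extract S uq (λ y∈ → ∈-∷⁻ (∈-resp-↭ p (S⊆L (there y∈))) (All.lookup x∉S y∈ ∘ sym))
  ... | X , q = X , ↭-trans p (prep x q)

  splitK₄ : ∀ L → (∃ λ S → ∃ λ X → K₄ S × L ↭ S ++ X) ⊎ K₄Free L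
  splitK₄ L with any? (λ a → any? (λ b → inTriangle? b (N a L)) (N a L)) L
  ... | no ¬k = inj₂ λ a∈ b∈ c∈ d∈ a~b a~c a~d b~c b~d c~d →
    ¬k (lose a∈ (lose (N⁺ b∈ a~b) (_ , _ , (N⁺ c∈ a~c , N⁺ d∈ a~d) , (b~c , b~d , c~d))))
  ... | yes p with a , a∈ , q ← find p
    with b , b∈ , (c , d , (c∈ , d∈) , (b~c , b~d , c~d)) ← find q
    with b∈L , a~b ← N⁻ {a} {b} L b∈ | c∈L , a~c ← N⁻ {a} {c} L c∈ | d∈L , a~d ← N⁻ {a} {d} L d∈
    = inj₁ (S , proj₁ ex , (clS , refl) , proj₂ ex)
    where
    S = a ∷ b ∷ c ∷ d ∷ []
    clS : Clique S
    clS = (a~b ∷ a~c ∷ a~d ∷ []) ∷ (b~c ∷ b~d ∷ []) ∷ (c~d ∷ []) ∷ [] ∷ []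
    ex = extract S {L} (Clique-unique clS) λ
      { (here refl) → a∈ ; (there (here refl)) → b∈L ; (there (there (here refl))) → c∈L
      ; (there (there (there (here refl)))) → d∈L }

  length-K₄-++ : ∀ {S} X → K₄ S → length (S ++ X) ≡ 4 + length X
  length-K₄-++ {S} X (_ , len) = trans (List.length-++ S {X}) (cong (_+ length X) len)

  module _ {S R Y : List V} (kS : K₄ S) (kR : K₄ R) (uq : Unique (S ++ R ++ Y)) where

    private
      step₁ : tri (S ++ R ++ Y) + defect S (R ++ Y) ≤ 4 + (4 + length Y) + tri (R ++ Y)
      step₁ = subst (λ n → tri (S ++ R ++ Y) + defect S (R ++ Y) ≤ 4 + n + tri (R ++ Y)) (length-K₄-++ Y kR)
        (tri+defect≤ S (R ++ Y) kS uq)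

      step₂ : tri (R ++ Y) + defect R Y ≤ 4 + length Y + tri Y
      step₂ = tri+defect≤ R Y kR (Unique-++ʳ S uq)

      D₁₂ : 4 ≤ defect S (R ++ Y) + defect R Y
      D₁₂ = defect+defect≥4 {Z = []} kS kR refl uq (λ _ ())

      length₂ : length (S ++ R ++ Y) ≡ 8 + length Y
      length₂ = trans (length-K₄-++ (R ++ Y) kS) (cong (4 +_) (length-K₄-++ Y kR))

    two-K₄ : Bound Y → Bound (S ++ R ++ Y)
    two-K₄ (bound h) = bound (subst (λ n → 8 * tri (S ++ R ++ Y) ≤ n * n) (sym length₂)
      (pair-arith (tri (S ++ R ++ Y)) (tri (R ++ Y)) (tri Y) (defect S (R ++ Y)) (defect R Y) (length Y) step₁ step₂ D₁₂ h))

  -- The pair S, Q also has total defect at least 4 although R is removed in between: R takes the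
  -- part of Z, as a vertex of Q has at most one neighbour in R.
  three-K₄ : ∀ {S R Q Y} → K₄ S → K₄ R → K₄ Q → Unique (S ++ R ++ Q ++ Y) → Bound Y →
    Bound (S ++ R ++ Q ++ Y)
  three-K₄ {S} {R} {Q} {Y} kS kR kQ uq (bound h) =
    bound (subst (λ n → 8 * tri (S ++ R ++ Q ++ Y) ≤ n * n) (sym (trans (length-K₄-++ (R ++ Q ++ Y) kS) (cong (4 +_) length-RQY)))
      (triple-arith (tri (S ++ R ++ Q ++ Y)) (tri (R ++ Q ++ Y)) (tri (Q ++ Y)) (tri Y)
        (defect S (R ++ Q ++ Y)) (defect R (Q ++ Y)) (defect Q Y) (length Y)
        (subst (λ n → tri (S ++ R ++ Q ++ Y) + defect S (R ++ Q ++ Y) ≤ 4 + n + tri (R ++ Q ++ Y)) length-RQY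
          (tri+defect≤ S (R ++ Q ++ Y) kS uq))
        (subst (λ n → tri (R ++ Q ++ Y) + defect R (Q ++ Y) ≤ 4 + n + tri (Q ++ Y)) length-QY
          (tri+defect≤ R (Q ++ Y) kR uqR))
        (tri+defect≤ Q Y kQ (Unique-++ʳ R uqR))
        (defect+defect≥4 {Z = []} kS kR refl uq (λ _ ()))
        (defect+defect≥4 {Z = []} kR kQ refl uqR (λ _ ()))
        (defect+defect≥4 {Z = R} kS kQ (shifts R Q) uq λ u∈Q a∈R b∈R u~a u~b a~b →
          K₄-separated kR (λ u∈R → Unique-disjoint R uqR u∈R (∈-++⁺ˡ u∈Q)) a∈R b∈R (~⇒≢ a~b) u~a u~b)
        h))
    where
    uqR = Unique-++ʳ S uq
    length-QY : length (Q ++ Y) ≡ 4 + length Y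
    length-QY = length-K₄-++ Y kQ
    length-RQY : length (R ++ Q ++ Y) ≡ 8 + length Y
    length-RQY = trans (length-K₄-++ (Q ++ Y) kR) (cong (4 +_) length-QY)

  Bound-↭ : ∀ {K L} → K ↭ L → Bound L → Bound K
  Bound-↭ p (bound h) = bound (subst₂ (λ t n → 8 * t ≤ n * n) (sym (tri-↭ ~-sym p)) (sym (↭-length p)) h)

  -- K₄s are split off in pairs. If a single Q is left over, Y itself need not satisfy the bound (it
  -- may be just a K₄), so Q is removed together with the last pair. The number `k` bounds |Y| for
  -- termination.
  disjoint-K₄s⇒bound : ∀ {S R Y} → K₄ S → K₄ R → Unique (S ++ R ++ Y) → Bound (S ++ R ++ Y)
  disjoint-K₄s⇒bound {Y = Y} = go (length Y) ≤-refl
    where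
    go : ∀ k {S R Y} → length Y ≤ k → K₄ S → K₄ R → Unique (S ++ R ++ Y) → Bound (S ++ R ++ Y)
    go k {S} {R} {Y} len kS kR uq with splitK₄ Y
    ... | inj₂ free = two-K₄ kS kR uq (k₄Free⇒bound Y (Unique-++ʳ R (Unique-++ʳ S uq)) free)
    ... | inj₁ (Q , Y′ , kQ , p) with splitK₄ Y′
    ... | inj₂ free = Bound-↭ SRp (three-K₄ kS kR kQ uq′ (k₄Free⇒bound Y′ (Unique-++ʳ Q (Unique-++ʳ R (Unique-++ʳ S uq′))) free))
      where
      SRp = ++⁺ˡ S (++⁺ˡ R p)
      uq′ = Unique-↭ SRp uq
    go zero {Y = Y} len kS kR uq | inj₁ (Q , Y′ , kQ , p) | inj₁ _ =
      ⊥-elim (<⇒≱ (s≤s z≤n) (subst (_≤ 0) (trans (↭-length p) (length-K₄-++ Y′ kQ)) len))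
    go (suc k) {S} {R} {Y} len kS kR uq | inj₁ (Q , Y′ , kQ , p) | inj₁ (P , Y″ , kP , q) =
      two-K₄ kS kR uq (Bound-↭ QPp (go k len′ kQ kP (Unique-↭ QPp (Unique-++ʳ R (Unique-++ʳ S uq)))))
      where
      QPp = ↭-trans p (++⁺ˡ Q q)
      len′ : length Y″ ≤ k
      len′ = m+n≤o⇒n≤o 7 (≤-pred (subst (_≤ suc k)
        (trans (↭-length QPp) (trans (length-K₄-++ (P ++ Y″) kQ) (cong (4 +_) (length-K₄-++ Y″ kP)))) len))

  -- A K₄ whose complement is K₄-free.

  defect≥2⇒bound : ∀ {S X} → K₄ S → Unique (S ++ X) → K₄Free X → 2 ≤ defect S X → Bound (S ++ X)
  defect≥2⇒bound {S} {X} kS uq free 2≤D = bound (subst (λ n → 8 * tri (S ++ X) ≤ n * n) (sym (length-K₄-++ X kS))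
    (defect-arith (tri (S ++ X)) (defect S X) (length X) (tri X) (tri+defect≤ S X kS uq) 2≤D
      (k₄Free⇒8tri≤n² X (Unique-++ʳ S uq) free)))

  -- With v in a K₄ S and X the remaining vertices, it says that no K₄ meets S in v alone.
  NoTriangleIn : V → List V → Set
  NoTriangleIn v X = ∀ {u} → u ∈ N v X → ¬ InTriangle u (N v X)

  -- Summing over a triangle T of X: every vertex of T is charged to defect S X, and each link takes at most two of the charges.
  triangle⇒defect≥2 : ∀ {S X T} → K₄ S → Unique (S ++ X) → (∀ {v} → v ∈ S → NoTriangleIn v X) →
    Clique T → length T ≡ 3 → (∃ λ W → X ↭ T ++ W) → 2 ≤ defect S X
  triangle⇒defect≥2 {S} {X} {T@(a ∷ b ∷ c ∷ [])} kS uq no-tri ((a~b ∷ a~c ∷ []) ∷ (b~c ∷ []) ∷ [] ∷ []) refl (W , X↭) =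
    -- Three charges, at most two on each unit of the defect, give 3 ≤ 2 · defect.
    *-cancelˡ-< 2 1 (defect S X) (begin
      3                                            ≤⟨ ∑-mono T {λ _ → 1} token ⟩
      ∑ T (λ u → ∑ (N u S) f + i u)                ≡⟨ ∑-+ T (λ u → ∑ (N u S) f) i ⟩
      ∑ T (λ u → ∑ (N u S) f) + ∑ T i              ≡⟨ cong (_+ ∑ T i) (∑-degree-swap ~-sym S T f) ⟨
      ∑ S (λ v → f v * length (N v T)) + ∑ T i     ≤⟨ +-mono-≤ (∑-mono S λ {v} v∈ → ≤-trans (*-monoʳ-≤ (f v) (≤-pred (|NT|<3 v∈))) (≤-reflexive (*-comm (f v) 2))) via-X ⟩
      ∑ S (λ v → 2 * f v) + ∑ X i                  ≡⟨ cong (_+ ∑ X i) (∑-* S 2 f) ⟩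
      2 * ∑ S f + ∑ X i                            ≤⟨ +-monoʳ-≤ (2 * ∑ S f) (m≤m+n (∑ X i) _) ⟩
      2 * ∑ S f + 2 * ∑ X i                        ≡⟨ *-distribˡ-+ 2 (∑ S f) (∑ X i) ⟨
      2 * defect S X                                    ∎)
    where
    open ≤-Reasoning
    f i : V → ℕ
    f v = deficit v X
    i x = 1 ∸ length (N x S)
    uqX = Unique-++ʳ S uq
    T⊆X : ∀ {x} → x ∈ T → x ∈ X
    T⊆X x∈ = ∈-resp-↭ (↭-sym X↭) (∈-++⁺ˡ x∈)
    token : ∀ {u} → u ∈ T → 1 ≤ ∑ (N u S) f + i u
    token {u} u∈ with N u S in eq
    ... | [] = s≤s z≤n
    ... | v ∷ vs = let v∈ , u~v = N⁻ {u} {v} S (subst (v ∈_) (sym eq) (here refl))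
                       u∈X = T⊆X u∈
                   in m≤n⇒m≤n+o (1 ∸ suc (length vs)) (m≤n⇒m≤n+o (∑ vs f)
                        (deficit≥1 uqX u∈X (~-sym u~v) (no-tri v∈ (N⁺ u∈X (~-sym u~v)))))
    -- A vertex of S adjacent to all of T would form a K₄ with it, contrary to `no-tri`.
    missing : ∀ {v} → v ∈ S → Any (λ u → ¬ v ~ u) T
    missing {v} v∈ with v ~? a | v ~? b | v ~? c
    ... | no ¬a | _ | _ = here ¬a
    ... | _ | no ¬b | _ = there (here ¬b)
    ... | _ | _ | no ¬c = there (there (here ¬c))
    ... | yes v~a | yes v~b | yes v~c = ⊥-elim (no-tri v∈ (N⁺ (T⊆X (here refl)) v~a)
      (b , c , (N⁺ (T⊆X (there (here refl))) v~b , N⁺ (T⊆X (there (there (here refl)))) v~c) , (a~b , a~c , b~c)))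
    |NT|<3 : ∀ {v} → v ∈ S → length (N v T) < 3
    |NT|<3 {v} v∈ = List.filter-notAll (v ~?_) T (missing v∈)
    via-X : ∑ T i ≤ ∑ X i
    via-X = ≤-trans (m≤m+n (∑ T i) (∑ W i)) (≤-reflexive (trans (sym (∑-++ T W i)) (sym (∑-↭ i X↭))))

  extract-triangle : ∀ {a b c X} → a ∈ X → b ∈ X → c ∈ X → Clique (a ∷ b ∷ c ∷ []) → ∃ λ W → X ↭ a ∷ b ∷ c ∷ W
  extract-triangle a∈ b∈ c∈ cl = extract _ (Clique-unique cl) λ
    { (here refl) → a∈ ; (there (here refl)) → b∈ ; (there (there (here refl))) → c∈ }

  -- If X contains a triangle, the defect is at least 2. If not, the deletion bound leaves at most n
  -- triangles, and 8n ≤ n² for n ≥ 8.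
  lone-K₄⇒bound : ∀ {S X} → K₄ S → Unique (S ++ X) → K₄Free X → 8 ≤ length (S ++ X) →
    (∀ {v} → v ∈ S → NoTriangleIn v X) → Bound (S ++ X)
  lone-K₄⇒bound {S} {X} kS uq free 8≤n no-tri with tri X in eq
  ... | zero = bound (*-mono-≤ 8≤n tri≤n)
    where
    open ≤-Reasoning
    tri≤n : tri (S ++ X) ≤ length (S ++ X)
    tri≤n = begin
      tri (S ++ X)                ≤⟨ m≤m+n _ (defect S X) ⟩
      tri (S ++ X) + defect S X        ≤⟨ tri+defect≤ S X kS uq ⟩
      4 + length X + tri X        ≡⟨ trans (cong (4 + length X +_) eq) (+-identityʳ (4 + length X)) ⟩
      4 + length X                ≡⟨ length-K₄-++ X kS ⟨
      length (S ++ X)             ∎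
  ... | suc _ with a , b , c , (a∈ , b∈ , c∈) , (a~b , a~c , b~c) ← tri>0⇒triangle X (subst (0 <_) (sym eq) (s≤s z≤n))
    = defect≥2⇒bound kS uq free (triangle⇒defect≥2 kS uq no-tri cl refl (extract-triangle a∈ b∈ c∈ cl))
    where
    cl : Clique (a ∷ b ∷ c ∷ [])
    cl = (a~b ∷ a~c ∷ []) ∷ (b~c ∷ []) ∷ [] ∷ []

  ∑-edges≤ : ∀ {S W} → Unique W → Unique S → (∀ {w} → w ∈ W → SeparatedFrom w S) →
    ∑ S (λ u → edges (N u W)) ≤ length W
  ∑-edges≤ {S} {W} uqW uqS sep = begin
    ∑ S (λ u → edges (N u W))         ≤⟨ ∑-mono S (λ {u} _ → pathFree⇒edges≤ (N u W) (N-unique u uqW) (N-pathFree u W)) ⟩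
    ∑ S (λ u → length (N u W))        ≡⟨ degree-swap S W ⟩
    ∑ W (λ w → length (N w S))        ≤⟨ ∑-mono W (λ w∈ → separated⇒|N|≤1 uqS (sep w∈)) ⟩
    ∑ W (λ _ → 1)                     ≡⟨ trans (∑-const W 1) (*-identityʳ (length W)) ⟩
    length W                          ∎
    where open ≤-Reasoning

  -- A link inside W has at most two vertices, hence at most half as many edges as vertices.
  2∑-edges≤ : ∀ {S W} → length W ≤ 2 → Unique S → (∀ {w} → w ∈ W → SeparatedFrom w S) →
    2 * ∑ S (λ u → edges (N u W)) ≤ length W
  2∑-edges≤ {S} {W} |W|≤2 uqS sep = begin
    2 * ∑ S (λ u → edges (N u W))     ≡⟨ ∑-* S 2 (λ u → edges (N u W)) ⟨
    ∑ S (λ u → 2 * edges (N u W))     ≤⟨ ∑-mono S (λ {u} _ → 2edges≤ (N u W) (≤-trans (|N|≤ u W) |W|≤2)) ⟩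
    ∑ S (λ u → length (N u W))        ≡⟨ degree-swap S W ⟩
    ∑ W (λ w → length (N w S))        ≤⟨ ∑-mono W (λ w∈ → separated⇒|N|≤1 uqS (sep w∈)) ⟩
    ∑ W (λ _ → 1)                     ≡⟨ trans (∑-const W 1) (*-identityʳ (length W)) ⟩
    length W                          ∎
    where
    open ≤-Reasoning
    2choose₂≤ : ∀ n → n ≤ 2 → 2 * choose₂ n ≤ n
    2choose₂≤ 0 _ = z≤n
    2choose₂≤ 1 _ = z≤n
    2choose₂≤ 2 _ = ≤-refl
    2choose₂≤ (suc (suc (suc n))) (s≤s (s≤s ()))
    2edges≤ : ∀ M → length M ≤ 2 → 2 * edges M ≤ length M
    2edges≤ M l = ≤-trans (*-monoʳ-≤ 2 (edges≤choose₂ M)) (2choose₂≤ (length M) l)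

  tri-K₄-++≤ : ∀ {S X} → K₄ S → Unique (S ++ X) → tri (S ++ X) ≤ 4 + ∑ S (λ u → edges (N u X)) + tri X
  tri-K₄-++≤ {S} {X} k@(cl , len) uq = ≤-trans
    (≤-reflexive (tri-++ S X cl (λ x∈ → K₄-separated k (outside S uq x∈))))
    (+-monoˡ-≤ (tri X) (+-monoˡ-≤ _ (≤-trans (tri≤choose₃ S) (≤-reflexive (cong choose₃ len)))))

  -- The first vertex of a nonempty link lies in a triangle or in a star component; the latter makes
  -- the deficit positive.
  link-status : ∀ {v X} → Unique X →
    (∃ λ u → u ∈ N v X × InTriangle u (N v X)) ⊎ (N v X ≡ [] ⊎ 1 ≤ deficit v X)
  link-status {v} {X} uq with N v X in eq
  ... | [] = inj₂ (inj₁ refl)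
  ... | u ∷ us with inTriangle? u (u ∷ us)
  ... | yes t = inj₁ (u , here refl , t)
  ... | no ¬t = let u∈ , v~u = N⁻ {v} {u} X (subst (u ∈_) (sym eq) (here refl))
                in inj₂ (inj₂ (subst (λ M → 1 ≤ length M ∸ edges M) eq
                     (deficit≥1 uq u∈ v~u (subst (λ M → ¬ InTriangle u M) (sym eq) ¬t))))

  -- The neighbours of y lie among z and the two vertices of P, giving at most three triangles;
  -- after that z is in at most one, with P.
  delete-two : ∀ {y z P X} → length P ≡ 2 → N y X ≡ [] → N z X ≡ [] → 7 ≤ length (P ++ X) →
    Bound (P ++ X) → Bound (y ∷ z ∷ P ++ X)
  delete-two {y} {z} {P} {X} len Ny Nz 7≤n (bound h) =
    bound (delete-two-arith (tri (y ∷ z ∷ P ++ X)) (tri (P ++ X)) (length (P ++ X)) t≤ 7≤n h)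
    where
    open ≤-Reasoning
    edges-N≤ : ∀ u K → N u X ≡ [] → edges (N u (K ++ X)) ≤ choose₂ (length K)
    edges-N≤ u K Nu = begin
      edges (N u (K ++ X))        ≡⟨ cong edges (trans (N-++ u K X) (cong (N u K ++_) Nu)) ⟩
      edges (N u K ++ [])         ≡⟨ cong edges (List.++-identityʳ (N u K)) ⟩
      edges (N u K)               ≤⟨ ≤-trans (edges≤choose₂ (N u K)) (choose₂-mono (|N|≤ u K)) ⟩
      choose₂ (length K)               ∎
    t≤ : tri (y ∷ z ∷ P ++ X) ≤ 4 + tri (P ++ X)
    t≤ = begin
      edges (N y (z ∷ P ++ X)) + (edges (N z (P ++ X)) + tri (P ++ X))
        ≤⟨ +-mono-≤ (edges-N≤ y (z ∷ P) Ny) (+-monoˡ-≤ (tri (P ++ X)) (edges-N≤ z P Nz)) ⟩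
      choose₂ (suc (length P)) + (choose₂ (length P) + tri (P ++ X))
        ≡⟨ cong (λ n → choose₂ (suc n) + (choose₂ n + tri (P ++ X))) len ⟩
      4 + tri (P ++ X) ∎

  tri≡0 : ∀ X → length X ≤ 2 → tri X ≡ 0
  tri≡0 X h = n≤0⇒n≡0 (≤-trans (tri≤choose₃ X) (choose₃≤0 (length X) h))
    where
    choose₃≤0 : ∀ n → n ≤ 2 → choose₃ n ≤ 0
    choose₃≤0 0 _ = z≤n
    choose₃≤0 1 _ = z≤n
    choose₃≤0 2 _ = z≤n
    choose₃≤0 (suc (suc (suc n))) (s≤s (s≤s ()))

  -- Two K₄s sharing a single vertex.

  module TwoAtVertex {v : V} {S T W : List V}
    (kS : K₄ (v ∷ S)) (kR : K₄ (v ∷ T)) (uq : Unique ((v ∷ S) ++ T ++ W)) where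

    private
      X = T ++ W
      clS = proj₁ kS
      clR = proj₁ kR
      clT : Clique T
      clT = AllPairs.tail clR
      |T|≡3 : length T ≡ 3
      |T|≡3 = suc-injective (proj₂ kR)
      uqX : Unique X
      uqX = Unique-++ʳ (v ∷ S) uq
      v∉ : ∀ {u} → u ∈ S ++ X → v ≢ u
      v∉ = All.lookup (AllPairs.head uq)
      S-sep : ∀ {u} → u ∈ X → SeparatedFrom u (v ∷ S)
      S-sep u∈ = K₄-separated kS (outside (v ∷ S) uq u∈)
      R-sep : ∀ {u} → u ∈ W → SeparatedFrom u (v ∷ T)
      R-sep u∈ = K₄-separated kR λ
        { (here refl) → v∉ (∈-++⁺ʳ S (∈-++⁺ʳ T u∈)) refl
        ; (there u∈T) → Unique-disjoint T uqX u∈T u∈ }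
      v~T : ∀ {u} → u ∈ T → v ~ u
      v~T = All.lookup (AllPairs.head clR)
      S≁T : ∀ {s u} → s ∈ S → u ∈ T → ¬ s ~ u
      S≁T s∈ u∈ s~u = S-sep (∈-++⁺ˡ u∈) (here refl) (there s∈) (v∉ (∈-++⁺ˡ s∈)) (~-sym (v~T u∈)) (~-sym s~u)

    -- The two K₄s contain four triangles each, and S has no edges to T. Every other triangle joins
    -- a vertex of the K₄s to an edge in W, which is too small to contain a triangle.
    tri≤ : length W ≤ 2 →
      tri ((v ∷ S) ++ X) ≤ 8 + (∑ (v ∷ S) (λ u → edges (N u W)) + ∑ T (λ u → edges (N u W)))
    tri≤ |W|≤2 = begin
      tri ((v ∷ S) ++ X)
        ≤⟨ tri-K₄-++≤ kS uq ⟩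
      4 + (edges (N v X) + ∑ S (λ u → edges (N u X))) + tri X
        ≤⟨ +-mono-≤ (+-monoʳ-≤ 4 (+-mono-≤ at-v (≤-reflexive at-S))) triX ⟩
      4 + (3 + edges (N v W) + ∑ S (λ u → edges (N u W))) + (1 + ∑ T (λ u → edges (N u W)))
        ≡⟨ arith (edges (N v W)) (∑ S (λ u → edges (N u W))) (∑ T (λ u → edges (N u W))) ⟩
      8 + (∑ (v ∷ S) (λ u → edges (N u W)) + ∑ T (λ u → edges (N u W))) ∎
      where
      open ≤-Reasoning
      arith : ∀ p q r → 4 + (3 + p + q) + (1 + r) ≡ 8 + (p + q + r)
      arith = solve-∀
      at-v : edges (N v X) ≤ 3 + edges (N v W)
      at-v = begin
        edges (N v (T ++ W))            ≡⟨ cong edges (trans (N-++ v T W) (cong (_++ N v W) (N-all v T v~T))) ⟩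
        edges (T ++ N v W)              ≡⟨ edges-++ T (N v W) (λ {p} {w} p∈ w∈ p~w → let w∈W , v~w = N⁻ {v} {w} W w∈ in
                                             R-sep w∈W (here refl) (there p∈) (~⇒≢ (v~T p∈)) (~-sym v~w) (~-sym p~w)) ⟩
        edges T + edges (N v W)         ≤⟨ +-monoˡ-≤ (edges (N v W)) (≤-trans (edges≤choose₂ T) (≤-reflexive (cong choose₂ |T|≡3))) ⟩
        3 + edges (N v W)               ∎
      at-S : ∑ S (λ u → edges (N u X)) ≡ ∑ S (λ u → edges (N u W))
      at-S = ∑-cong S λ {u} u∈ → cong edges (trans (N-++ u T W) (cong (_++ N u W) (N-none u T (S≁T u∈))))
      triX : tri X ≤ 1 + ∑ T (λ u → edges (N u W))
      triX = begin
        tri (T ++ W)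
          ≡⟨ tri-++ T W clT (λ w∈ u∈ v∈ → R-sep w∈ (there u∈) (there v∈)) ⟩
        tri T + ∑ T (λ u → edges (N u W)) + tri W
          ≤⟨ +-mono-≤ (+-monoˡ-≤ _ (≤-trans (tri≤choose₃ T) (≤-reflexive (cong choose₃ |T|≡3)))) (≤-reflexive (tri≡0 W |W|≤2)) ⟩
        1 + ∑ T (λ u → edges (N u W)) + 0
          ≡⟨ +-identityʳ (1 + ∑ T (λ u → edges (N u W))) ⟩
        1 + ∑ T (λ u → edges (N u W)) ∎

    few-outside : 1 ≤ length W → length W ≤ 2 → Bound ((v ∷ S) ++ X)
    few-outside 1≤w w≤2 = bound (subst (λ n → 8 * tri ((v ∷ S) ++ X) ≤ n * n) (sym |L|≡)
      (few-outside-arith (length W) (tri ((v ∷ S) ++ X)) (∑ (v ∷ S) (λ u → edges (N u W))) (∑ T (λ u → edges (N u W)))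
        1≤w w≤2 (tri≤ w≤2)
        (2∑-edges≤ w≤2 (Clique-unique clS) (λ w∈ → S-sep (∈-++⁺ʳ T w∈)))
        (2∑-edges≤ w≤2 (Clique-unique clT) (λ w∈ u∈ v∈ → R-sep w∈ (there u∈) (there v∈)))))
      where
      |L|≡ : length ((v ∷ S) ++ X) ≡ 7 + length W
      |L|≡ = trans (length-K₄-++ X kS) (cong (4 +_) (trans (List.length-++ T {W}) (cong (_+ length W) |T|≡3)))

    -- The triangle in the link of s forms with s a K₄ disjoint from v ∷ T: a vertex of T is already
    -- adjacent to v, so not also to s.
    disjoint-K₄s : ∀ {s} → s ∈ S → (∃ λ u → u ∈ N s X × InTriangle u (N s X)) → Bound ((v ∷ S) ++ X)
    disjoint-K₄s {s} s∈ (d , d∈ , e , f , (e∈ , f∈) , (d~e , d~f , e~f)) =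
      Bound-↭ (proj₂ ex) (disjoint-K₄s⇒bound {S = P} {R = v ∷ T} {Y = proj₁ ex} kP kR (Unique-↭ (proj₂ ex) uq))
      where
      P = s ∷ d ∷ e ∷ f ∷ []
      s~ : ∀ {u} → u ∈ N s X → s ~ u
      s~ u∈ = proj₂ (N⁻ X u∈)
      ∈X : ∀ {u} → u ∈ N s X → u ∈ X
      ∈X u∈ = proj₁ (N⁻ {s} X u∈)
      kP : K₄ P
      kP = ((s~ d∈ ∷ s~ e∈ ∷ s~ f∈ ∷ []) ∷ (d~e ∷ d~f ∷ []) ∷ (e~f ∷ []) ∷ [] ∷ []) , refl
      ∉R : ∀ {u} → u ∈ N s X → u ∉ v ∷ T
      ∉R u∈ (here refl) = v∉ (∈-++⁺ʳ S (∈X u∈)) refl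
      ∉R u∈ (there u∈T) = S≁T s∈ u∈T (s~ u∈)
      P∩R : ∀ {u} → ¬ (u ∈ P × u ∈ v ∷ T)
      P∩R (here refl , here refl) = v∉ (∈-++⁺ˡ s∈) refl
      P∩R (here refl , there u∈T) = Unique-disjoint (v ∷ S) uq (there s∈) (∈-++⁺ˡ u∈T)
      P∩R (there (here refl) , u∈) = ∉R d∈ u∈
      P∩R (there (there (here refl)) , u∈) = ∉R e∈ u∈
      P∩R (there (there (there (here refl))) , u∈) = ∉R f∈ u∈
      P⊆ : ∀ {u} → u ∈ P → u ∈ (v ∷ S) ++ X
      P⊆ (here refl) = ∈-++⁺ˡ (there s∈)
      P⊆ (there (here refl)) = ∈-++⁺ʳ (v ∷ S) (∈X d∈)
      P⊆ (there (there (here refl))) = ∈-++⁺ʳ (v ∷ S) (∈X e∈)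
      P⊆ (there (there (there (here refl)))) = ∈-++⁺ʳ (v ∷ S) (∈X f∈)
      R⊆ : ∀ {u} → u ∈ v ∷ T → u ∈ (v ∷ S) ++ X
      R⊆ (here refl) = here refl
      R⊆ (there u∈T) = ∈-++⁺ʳ (v ∷ S) (∈-++⁺ˡ u∈T)
      PR⊆ : ∀ {u} → u ∈ P ++ v ∷ T → u ∈ (v ∷ S) ++ X
      PR⊆ u∈ with ∈-++⁻ P u∈
      ... | inj₁ u∈P = P⊆ u∈P
      ... | inj₂ u∈R = R⊆ u∈R
      ex = extract (P ++ v ∷ T) {(v ∷ S) ++ X} (Unique.++⁺ (Clique-unique (proj₁ kP)) (Clique-unique clR) P∩R) PR⊆

  -- By pigeonhole among x, y, z: some link contains a triangle and yields disjoint K₄s; or two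
  -- deficits are positive, so the defect is at least 2; or two links are empty, and deleting these
  -- two vertices leaves 2 + |X| for the induction.
  many-outside : ∀ {v x y z T W} → K₄ (v ∷ x ∷ y ∷ z ∷ []) → K₄ (v ∷ T) → Unique ((v ∷ x ∷ y ∷ z ∷ []) ++ T ++ W) →
    K₄Free (T ++ W) → 5 ≤ length (T ++ W) → (∀ K → length K ≡ 2 + length (T ++ W) → Unique K → Bound K) →
    Bound ((v ∷ x ∷ y ∷ z ∷ []) ++ T ++ W)
  many-outside {v} {x} {y} {z} {T} {W} kS kR uq free 5≤ IH = go (link-status uqX) (link-status uqX) (link-status uqX)
    where
    open TwoAtVertex kS kR uq
    S = v ∷ x ∷ y ∷ z ∷ []
    X = T ++ W
    uqX : Unique X
    uqX = Unique-++ʳ S uq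
    d : V → ℕ
    d u = deficit u X
    D≥ : 2 ≤ d v + (d x + (d y + (d z + 0))) → Bound (S ++ X)
    D≥ h = defect≥2⇒bound kS uq free (m≤n⇒m≤n+o (∑ X _) h)
    delete : ∀ {y z P} → S ++ X ↭ y ∷ z ∷ P ++ X → length P ≡ 2 → N y X ≡ [] → N z X ≡ [] → Bound (S ++ X)
    delete {y} {z} {P} p len Ny Nz = Bound-↭ p (delete-two {P = P} len Ny Nz
      (≤-trans (+-monoʳ-≤ 2 5≤) (≤-reflexive (sym |PX|))) (IH (P ++ X) |PX| (Unique-++ʳ (y ∷ z ∷ []) (Unique-↭ p uq))))
      where
      |PX| : length (P ++ X) ≡ 2 + length X
      |PX| = trans (List.length-++ P {X}) (cong (_+ length X) len)
    Status : V → Set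
    Status s = (∃ λ u → u ∈ N s X × InTriangle u (N s X)) ⊎ (N s X ≡ [] ⊎ 1 ≤ deficit s X)
    go : Status x → Status y → Status z → Bound (S ++ X)
    go (inj₁ t) _ _ = disjoint-K₄s (here refl) t
    go _ (inj₁ t) _ = disjoint-K₄s (there (here refl)) t
    go _ _ (inj₁ t) = disjoint-K₄s (there (there (here refl))) t
    go (inj₂ (inj₂ dx)) (inj₂ (inj₂ dy)) _ = D≥ (m≤n⇒m≤o+n (d v) (+-mono-≤ dx (m≤n⇒m≤n+o (d z + 0) dy)))
    go (inj₂ (inj₂ dx)) _ (inj₂ (inj₂ dz)) =
      D≥ (m≤n⇒m≤o+n (d v) (+-mono-≤ dx (m≤n⇒m≤o+n (d y) (m≤n⇒m≤n+o 0 dz))))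
    go _ (inj₂ (inj₂ dy)) (inj₂ (inj₂ dz)) =
      D≥ (m≤n⇒m≤o+n (d v) (m≤n⇒m≤o+n (d x) (+-mono-≤ dy (m≤n⇒m≤n+o 0 dz))))
    go _ (inj₂ (inj₁ Ny)) (inj₂ (inj₁ Nz)) =
      delete {P = v ∷ x ∷ []} (shifts (v ∷ x ∷ []) (y ∷ z ∷ [])) refl Ny Nz
    go (inj₂ (inj₁ Nx)) _ (inj₂ (inj₁ Nz)) =
      delete {P = v ∷ y ∷ []} (↭-trans (prep v (swap x y refl)) (shifts (v ∷ y ∷ []) (x ∷ z ∷ []))) refl Nx Nz
    go (inj₂ (inj₁ Nx)) (inj₂ (inj₁ Ny)) _ =
      delete {P = v ∷ z ∷ []} (shifts (v ∷ []) (x ∷ y ∷ [])) refl Nx Ny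

  n≥8⇒bound : ∀ L → Unique L → 8 ≤ length L → Bound L
  n≥8⇒bound L = go (length L) L ≤-refl
    where
    go : ∀ k L → length L ≤ k → Unique L → 8 ≤ length L → Bound L
    go zero    L len uq 8≤n = ⊥-elim (<⇒≱ (≤-trans (s≤s z≤n) 8≤n) len)
    go (suc k) L len uq 8≤n with splitK₄ L
    ... | inj₂ free = k₄Free⇒bound L uq free
    ... | inj₁ (S , X , kS , L↭) with splitK₄ X
    ... | inj₁ (R , Y , kR , X↭) = Bound-↭ p (disjoint-K₄s⇒bound kS kR (Unique-↭ p uq))
      where p = ↭-trans L↭ (++⁺ˡ S X↭)
    -- A triangle in the link of v outside S is a second K₄ sharing only v with S.
    ... | inj₂ free with any? (λ v → any? (λ u → inTriangle? u (N v X)) (N v X)) S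
    ... | no ¬t = Bound-↭ L↭ (lone-K₄⇒bound kS (Unique-↭ L↭ uq) free (subst (8 ≤_) (↭-length L↭) 8≤n)
                    λ v∈ u∈ t → ¬t (lose v∈ (lose u∈ t)))
    ... | yes t with v , v∈S , t′ ← find t
      with a , a∈ , b , c , (b∈ , c∈) , (a~b , a~c , b~c) ← find t′
      with S′ , S↭ ← ∈⇒↭ v∈S
      = two S′ (Clique-↭ S↭ (proj₁ kS)) (trans (sym (↭-length S↭)) (proj₂ kS)) (↭-trans L↭ (++⁺ʳ X S↭))
      where
      clR : Clique (v ∷ a ∷ b ∷ c ∷ [])
      clR = (proj₂ (N⁻ X a∈) ∷ proj₂ (N⁻ X b∈) ∷ proj₂ (N⁻ X c∈) ∷ []) ∷ (a~b ∷ a~c ∷ []) ∷ (b~c ∷ []) ∷ [] ∷ []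
      two : ∀ S′ → Clique (v ∷ S′) → suc (length S′) ≡ 4 → L ↭ v ∷ S′ ++ X → Bound L
      two (x ∷ y ∷ z ∷ []) clS refl L↭ = outside-count (length W) refl
        where
        ex = extract-triangle {X = X} (proj₁ (N⁻ {v} X a∈)) (proj₁ (N⁻ {v} X b∈)) (proj₁ (N⁻ {v} X c∈)) (AllPairs.tail clR)
        W = proj₁ ex
        p : L ↭ v ∷ x ∷ y ∷ z ∷ a ∷ b ∷ c ∷ W
        p = ↭-trans L↭ (++⁺ˡ (v ∷ x ∷ y ∷ z ∷ []) (proj₂ ex))
        open TwoAtVertex {W = W} (clS , refl) (clR , refl) (Unique-↭ p uq)
        free′ : K₄Free (a ∷ b ∷ c ∷ W)
        free′ i j k l = free (back i) (back j) (back k) (back l)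
          where
          back : ∀ {u} → u ∈ a ∷ b ∷ c ∷ W → u ∈ X
          back = ∈-resp-↭ (↭-sym (proj₂ ex))
        IH : ∀ K → length K ≡ 5 + length W → 3 ≤ length W → Unique K → Bound K
        IH K e 3≤w uqK = go k K
          (≤-trans (≤-trans (≤-reflexive e) (n≤1+n _)) (≤-pred (≤-trans (≤-reflexive (sym (↭-length p))) len)))
          uqK (subst (8 ≤_) (sym e) (+-monoʳ-≤ 5 3≤w))
        -- Here n = 7 + |W|. The values n = 8 and 9 are counted directly; from |W| = 3 on, n ∸ 2 = 5
        -- + |W| is still at least 8, as the induction requires.
        outside-count : ∀ w → length W ≡ w → Bound L
        outside-count 0 e = ⊥-elim (<⇒≱ 8≤n (≤-reflexive (trans (↭-length p) (cong (7 +_) e))))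
        outside-count 1 e = Bound-↭ p (few-outside (≤-reflexive (sym e)) (≤-trans (≤-reflexive e) (s≤s z≤n)))
        outside-count 2 e = Bound-↭ p (few-outside (≤-trans (s≤s z≤n) (≤-reflexive (sym e))) (≤-reflexive e))
        outside-count (suc (suc (suc w))) e = Bound-↭ p (many-outside {T = a ∷ b ∷ c ∷ []} (clS , refl) (clR , refl) (Unique-↭ p uq) free′ (s≤s (s≤s (s≤s (≤-trans (n≤1+n 2) 3≤w))))
          λ K e′ → IH K e′ 3≤w)
          where
          3≤w : 3 ≤ length W
          3≤w = subst (3 ≤_) (sym e) (s≤s (s≤s (s≤s z≤n)))

  -- At most seven vertices, with a K₄.

  n≤6⇒tri≤ : ∀ {S X} → K₄ S → Unique (S ++ X) → length X ≤ 2 → 2 * tri (S ++ X) ≤ 8 + length X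
  n≤6⇒tri≤ {S} {X} kS uq x≤2 = begin
    2 * tri (S ++ X)         ≤⟨ *-monoʳ-≤ 2 (tri-K₄-++≤ kS uq) ⟩
    2 * (4 + E + tri X)      ≡⟨ cong (λ t → 2 * (4 + E + t)) (tri≡0 X x≤2) ⟩
    2 * (4 + E + 0)          ≡⟨ arith E ⟩
    8 + 2 * E                ≤⟨ +-monoʳ-≤ 8 (2∑-edges≤ x≤2 (Clique-unique (proj₁ kS)) (λ x∈ → K₄-separated kS (outside S uq x∈))) ⟩
    8 + length X             ∎
    where
    open ≤-Reasoning
    E = ∑ S (λ u → edges (N u X))
    arith : ∀ e → 2 * (4 + e + 0) ≡ 8 + 2 * e
    arith = solve-∀

  -- Four triangles in S, at most |X| = 3 with one vertex in S, at most one in X.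
  n≡7⇒tri≤8 : ∀ {S X} → K₄ S → Unique (S ++ X) → length X ≡ 3 → tri (S ++ X) ≤ 8
  n≡7⇒tri≤8 {S} {X} kS uq e = ≤-trans (tri-K₄-++≤ kS uq)
    (+-mono-≤ (+-monoʳ-≤ 4 (≤-trans (∑-edges≤ (Unique-++ʳ S uq) (Clique-unique (proj₁ kS))
        (λ x∈ → K₄-separated kS (outside S uq x∈))) (≤-reflexive e)))
      (≤-trans (tri≤choose₃ X) (≤-reflexive (cong choose₃ e))))

-- From adjacency functions to triangle counts on lists.

module _ {n : ℕ} (G : Graph n) where

  Adj : Fin n → Fin n → Set
  Adj i j = adj G i j ≡ true

  adj? : Decidable Adj
  adj? i j = adj G i j Bool.≟ true

  Adj-sym : Symmetric Adj
  Adj-sym {i} {j} e = trans (Graph.sym G j i) e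

  Adj-irrefl : ∀ {i} → ¬ Adj i i
  Adj-irrefl {i} e with () ← trans (sym e) (adj-irrefl G i)

  -- Adjacencies are interleaved with the quantifiers, so that evaluating `noP̂₄?` discards partial
  -- paths early.
  NoP̂₄ : Set
  NoP̂₄ = ∀ v a → Adj v a → ∀ b → Adj v b → Adj a b → ∀ c → Adj v c → Adj b c → a ≢ c →
    ∀ d → Adj v d → Adj c d → b ≢ d → a ≢ d → ⊥

  noP̂₄? : Dec NoP̂₄
  noP̂₄? = Fin.all? λ v → Fin.all? λ a → adj? v a →-dec Fin.all? λ b → adj? v b →-dec adj? a b →-dec
    Fin.all? λ c → adj? v c →-dec adj? b c →-dec ¬? (a Fin.≟ c) →-dec
    Fin.all? λ d → adj? v d →-dec adj? c d →-dec ¬? (b Fin.≟ d) →-dec ¬? (a Fin.≟ d) →-dec no id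

  noP̂₄⇒free : NoP̂₄ → Free G P4hat
  noP̂₄⇒free noP (f , inj , hom) =
    noP (f v) (f a) (hom v a refl) (f b) (hom v b refl) (hom a b refl) (f c) (hom v c refl) (hom b c refl)
      (λ e → case-≢ (inj e)) (f d) (hom v d refl) (hom c d refl) (λ e → case-≢ (inj e)) (λ e → case-≢ (inj e))
    where
    a b c d v : Fin 5
    a = f0
    b = fs f0
    c = fs (fs f0)
    d = fs (fs (fs f0))
    v = fs (fs (fs (fs f0)))
    case-≢ : ∀ {i j : Fin 5} {i≢j : False (i Fin.≟ j)} → i ≡ j → ⊥
    case-≢ {i≢j = i≢j} = toWitnessFalse i≢j

  free⇒noP̂₄ : Free G P4hat → ∀ {v a b c d} → Adj v a → Adj v b → Adj v c → Adj v d →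
    Adj a b → Adj b c → Adj c d → a ≢ c → b ≢ d → a ≢ d → ⊥
  free⇒noP̂₄ free {v} {a} {b} {c} {d} va vb vc vd ab bc cd a≢c b≢d a≢d =
    free (lookup vs , lookup-injective unique _ _ , hom)
    where
    vs = a ∷ b ∷ c ∷ d ∷ v ∷ []
    ≢ : ∀ {x y} → Adj x y → x ≢ y
    ≢ xy refl = Adj-irrefl xy
    unique = (≢ ab VecAll.∷ a≢c VecAll.∷ a≢d VecAll.∷ (≢ va ∘ sym) VecAll.∷ VecAll.[])
      VecPairs.∷ (≢ bc VecAll.∷ b≢d VecAll.∷ (≢ vb ∘ sym) VecAll.∷ VecAll.[])
      VecPairs.∷ (≢ cd VecAll.∷ (≢ vc ∘ sym) VecAll.∷ VecAll.[])
      VecPairs.∷ ((≢ vd ∘ sym) VecAll.∷ VecAll.[])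
      VecPairs.∷ VecAll.[] VecPairs.∷ VecPairs.[]
    hom : ∀ i j → p4adj i j ≡ true → Adj (lookup vs i) (lookup vs j)
    hom f0 (fs f0) _ = ab
    hom (fs f0) f0 _ = Adj-sym ab
    hom (fs f0) (fs (fs f0)) _ = bc
    hom (fs (fs f0)) (fs f0) _ = Adj-sym bc
    hom (fs (fs f0)) (fs (fs (fs f0))) _ = cd
    hom (fs (fs (fs f0))) (fs (fs f0)) _ = Adj-sym cd
    hom (fs (fs (fs (fs f0)))) (fs (fs (fs (fs f0)))) ()
    hom (fs (fs (fs (fs f0)))) f0 _ = va
    hom (fs (fs (fs (fs f0)))) (fs f0) _ = vb
    hom (fs (fs (fs (fs f0)))) (fs (fs f0)) _ = vc
    hom (fs (fs (fs (fs f0)))) (fs (fs (fs f0))) _ = vd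
    hom f0 (fs (fs (fs (fs f0)))) _ = Adj-sym va
    hom (fs f0) (fs (fs (fs (fs f0)))) _ = Adj-sym vb
    hom (fs (fs f0)) (fs (fs (fs (fs f0)))) _ = Adj-sym vc
    hom (fs (fs (fs f0))) (fs (fs (fs (fs f0)))) _ = Adj-sym vd

  open Counting adj?

  private
    _<ᶠ_ : Fin n → Fin n → Bool
    i <ᶠ j = toℕ i <ᵇ toℕ j

    Sorted : List (Fin n) → Set
    Sorted = AllPairs (λ i j → i <ᶠ j ≡ true)

    w : Fin n → Fin n → Fin n → ℕ
    w a b c = if isTri G a b c then 1 else 0

    ≥⇒<ᶠ : ∀ i j → toℕ j ≤ toℕ i → i <ᶠ j ≡ false
    ≥⇒<ᶠ i j j≤i with i <ᶠ j in eq
    ... | false = refl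
    ... | true  = ⊥-elim (<⇒≱ (<ᵇ⇒< (toℕ i) (toℕ j) (subst Bool.T (sym eq) _)) j≤i)

    <ᶠ-asym : ∀ {i j} → i <ᶠ j ≡ true → j <ᶠ i ≡ false
    <ᶠ-asym {i} {j} e = ≥⇒<ᶠ j i (<⇒≤ (<ᵇ⇒< (toℕ i) (toℕ j) (subst Bool.T (sym e) _)))

    w-≮₁ : ∀ {a b} c → a <ᶠ b ≡ false → w a b c ≡ 0
    w-≮₁ c e rewrite e = refl

    w-≮₂ : ∀ a {b c} → b <ᶠ c ≡ false → w a b c ≡ 0
    w-≮₂ a {b} e rewrite e = cong 𝟙 (Bool.∧-zeroʳ (a <ᶠ b))

    third-vertices : ∀ {a b} L → a <ᶠ b ≡ true → All (λ c → b <ᶠ c ≡ true) L → adj G a b ≡ true →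
      ∑ L (w a b) ≡ length (N b (N a L))
    third-vertices [] a<b [] a~b = refl
    third-vertices {a} {b} (c ∷ L) a<b (b<c ∷ b<L) a~b =
      trans (cong₂ _+_ w≡ (third-vertices {a} {b} L a<b b<L a~b)) count
      where
      w≡ : w a b c ≡ 𝟙 (adj G b c ∧ adj G a c)
      w≡ rewrite a<b | b<c | a~b = refl
      count : 𝟙 (adj G b c ∧ adj G a c) + length (N b (N a L)) ≡ length (N b (N a (c ∷ L)))
      count with adj G a c
      ... | false rewrite Bool.∧-zeroʳ (adj G b c) = refl
      ... | true with adj G b c
      ... | true  = refl
      ... | false = refl

    no-third-vertices : ∀ {a b} L → adj G a b ≡ false → ∑ L (w a b) ≡ 0
    no-third-vertices {a} {b} L e = ∑-zero L λ {c} _ → cong 𝟙 (zero-∧ (a <ᶠ b) (b <ᶠ c))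
      where
      zero-∧ : ∀ p q {r} → p ∧ q ∧ adj G a b ∧ r ≡ false
      zero-∧ p q rewrite e | Bool.∧-zeroʳ q = Bool.∧-zeroʳ p

    link-edges : ∀ {a} L → All (λ b → a <ᶠ b ≡ true) L → Sorted L → ∑ L (λ b → ∑ L (w a b)) ≡ edges (N a L)
    link-edges [] [] [] = refl
    link-edges {a} (y ∷ L) (a<y ∷ a<L) (y<L ∷ sorted) = begin
      w a y y + ∑ L (w a y) + ∑ L (λ b → w a b y + ∑ L (w a b))
        ≡⟨ cong₂ _+_ (cong (_+ ∑ L (w a y)) (w-≮₂ a {y} {y} (≥⇒<ᶠ y y ≤-refl)))
             (∑-cong L λ {b} b∈ → cong (_+ ∑ L (w a b)) (w-≮₂ a {b} {y} (<ᶠ-asym {y} {b} (All.lookup y<L b∈)))) ⟩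
      ∑ L (w a y) + ∑ L (λ b → ∑ L (w a b))
        ≡⟨ cong (∑ L (w a y) +_) (link-edges L a<L sorted) ⟩
      ∑ L (w a y) + edges (N a L)
        ≡⟨ first (adj? a y) ⟩
      edges (N a (y ∷ L)) ∎
      where
      open ≡-Reasoning
      first : Dec (Adj a y) → ∑ L (w a y) + edges (N a L) ≡ edges (N a (y ∷ L))
      first (yes e) = trans (cong (_+ edges (N a L)) (third-vertices {a} {y} L a<y y<L e)) (sym (cong edges (N-yes {a} {y} L e)))
      first (no ¬e) = trans (cong (_+ edges (N a L)) (no-third-vertices {a} {y} L (Bool.¬-not ¬e))) (sym (cong edges (N-no {a} {y} L ¬e)))

    -- A triple that is not strictly increasing has weight 0, so in an increasing list the triples
    -- containing the head x reduce to the edges of its link.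
    ∑w≡tri : ∀ L → Sorted L → ∑ L (λ a → ∑ L (λ b → ∑ L (w a b))) ≡ tri L
    ∑w≡tri [] [] = refl
    ∑w≡tri (x ∷ L) (x<L ∷ sorted) = cong₂ _+_
      (trans (cong₂ _+_ (∑-zero (x ∷ L) λ {c} _ → w-≮₁ {x} {x} c (≥⇒<ᶠ x x ≤-refl))
               (∑-cong L λ {b} b∈ → cong (_+ ∑ L (w x b)) (w-≮₂ x {b} {x} (<ᶠ-asym {x} {b} (All.lookup x<L b∈)))))
        (link-edges L x<L sorted))
      (trans (∑-cong L λ {a} a∈ → cong₂ _+_ (∑-zero (x ∷ L) λ {c} _ → w-≮₁ {a} {x} c (<ᶠ-asym {x} {a} (All.lookup x<L a∈)))
               (∑-cong L λ {b} b∈ → cong (_+ ∑ L (w a b)) (w-≮₂ a {b} {x} (<ᶠ-asym {x} {b} (All.lookup x<L b∈)))))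
        (∑w≡tri L sorted))

  triangles≡tri : triangles G ≡ tri (allFin n)
  triangles≡tri = ∑w≡tri (allFin n) (AllPairs.tabulate⁺-< λ i<j → Equivalence.to Bool.T-≡ (<⇒<ᵇ i<j))

-- Upper bounds for graphs on `Fin n`.

8m≤x⇒m≤x/8 : ∀ m x → 8 * m ≤ x → m ≤ x / 8
8m≤x⇒m≤x/8 m x h = subst (_≤ x / 8) (m*n/n≡m m 8) (/-monoˡ-≤ 8 (subst (_≤ x) (*-comm 8 m) h))

module _ {n : ℕ} (G : Graph n) (free : Free G P4hat) where
  open Suspension (adj? G) (Adj-sym G) (Adj-irrefl G) Fin._≟_ (free⇒noP̂₄ G free)

  private
    L = allFin n
    |L| : length L ≡ n
    |L| = List.length-tabulate id
    uq : Unique L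
    uq = Unique.allFin⁺ n

    from-bound : Bound L → triangles G ≤ n * n / 8
    from-bound (bound h) = 8m≤x⇒m≤x/8 (triangles G) (n * n)
      (subst₂ (λ t m → 8 * t ≤ m * m) (sym (triangles≡tri G)) |L| h)

  triangles≤n²/8 : 8 ≤ n → triangles G ≤ n * n / 8
  triangles≤n²/8 8≤n = from-bound (n≥8⇒bound L uq (subst (8 ≤_) (sym |L|) 8≤n))

  triangles-split : triangles G ≤ n * n / 8 ⊎
    (∃ λ S → ∃ λ X → K₄ S × Unique (S ++ X) × 4 + length X ≡ n × triangles G ≡ tri (S ++ X))
  triangles-split with splitK₄ L
  ... | inj₂ kf = inj₁ (from-bound (k₄Free⇒bound L uq kf))
  ... | inj₁ (S , X , kS , p) = inj₂ (S , X , kS , Unique-↭ p uq ,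
    trans (sym (length-K₄-++ X kS)) (trans (sym (↭-length p)) |L|) , trans (triangles≡tri G) (tri-↭ (Adj-sym G) p))

  -- Given a K₄, twice the count is at most 8 + x ≤ 2m + 1, so parity brings the count down to m;
  -- without one, n²/8 bounds it.
  triangles≤small : ∀ {x} m → n ≡ 4 + x → x ≤ 2 → n * n / 8 ≤ m → 8 + x ≤ suc (2 * m) → triangles G ≤ m
  triangles≤small {x} m n≡ x≤2 floor≤m 8+x≤ with triangles-split
  ... | inj₁ h = ≤-trans h floor≤m
  ... | inj₂ (S , X , kS , uqSX , e , t≡) = subst (_≤ m) (sym t≡) (≤-pred (*-cancelˡ-< 2 _ _
          (≤-trans (s≤s (n≤6⇒tri≤ kS uqSX (subst (_≤ 2) (sym |X|) x≤2)))
            (≤-trans (s≤s (subst (λ y → 8 + y ≤ suc (2 * m)) (sym |X|) 8+x≤)) (≤-reflexive (sym (*-suc 2 m)))))))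
    where
    |X| : length X ≡ x
    |X| = +-cancelˡ-≡ 4 (length X) x (trans e n≡)

  triangles≤8 : n ≡ 7 → triangles G ≤ 8
  triangles≤8 refl with triangles-split
  -- Without a K₄ the bound is ⌊49/8⌋ = 6.
  ... | inj₁ h = ≤-trans h (m≤m+n 6 2)
  ... | inj₂ (S , X , kS , uqSX , e , t≡) = subst (_≤ 8) (sym t≡) (n≡7⇒tri≤8 kS uqSX (+-cancelˡ-≡ 4 (length X) 3 e))

-- The extremal graphs.

module _ {V : Set} (_~ᵇ_ : V → V → Bool) (~ᵇ-sym : ∀ x y → x ~ᵇ y ≡ y ~ᵇ x) (~ᵇ-irrefl : ∀ x → x ~ᵇ x ≡ false) where

  listGraph : (xs : List V) → Graph (length xs)
  listGraph xs = record
    { adj    = λ i j → List.lookup xs i ~ᵇ List.lookup xs j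
    ; sym    = λ i j → ~ᵇ-sym (List.lookup xs i) (List.lookup xs j)
    ; irrefl = λ i → ~ᵇ-irrefl (List.lookup xs i)
    }

  _~ᵇ?_ : Decidable (λ x y → x ~ᵇ y ≡ true)
  x ~ᵇ? y = (x ~ᵇ y) Bool.≟ true

  triangles-listGraph : ∀ xs → triangles (listGraph xs) ≡ Counting.tri _~ᵇ?_ xs
  triangles-listGraph xs = begin
    triangles (listGraph xs)                    ≡⟨ triangles≡tri (listGraph xs) ⟩
    G.tri (allFin (length xs))                  ≡⟨ tri-map (allFin (length xs)) ⟩
    V′.tri (map lab (allFin (length xs)))        ≡⟨ cong V′.tri (trans (List.map-tabulate id lab) (List.tabulate-lookup xs)) ⟩
    V′.tri xs                                    ∎
    where
    open ≡-Reasoning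
    module G = Counting (adj? (listGraph xs))
    module V′ = Counting _~ᵇ?_
    lab = List.lookup xs
    map-N : ∀ i L → map lab (G.N i L) ≡ V′.N (lab i) (map lab L)
    map-N i [] = refl
    map-N i (j ∷ L) with lab i ~ᵇ lab j
    ... | true  = cong (lab j ∷_) (map-N i L)
    ... | false = map-N i L
    edges-map : ∀ L → G.edges L ≡ V′.edges (map lab L)
    edges-map [] = refl
    edges-map (i ∷ L) = cong₂ _+_ (trans (sym (List.length-map lab (G.N i L))) (cong length (map-N i L))) (edges-map L)
    tri-map : ∀ L → G.tri L ≡ V′.tri (map lab L)
    tri-map [] = refl
    tri-map (i ∷ L) = cong₂ _+_ (trans (edges-map (G.N i L)) (cong V′.edges (map-N i L))) (tri-map L)

lookup-injective-unique : {A : Set} {xs : List A} → Unique xs → ∀ {i j} → List.lookup xs i ≡ List.lookup xs j → i ≡ j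
lookup-injective-unique {xs = x ∷ xs} (x∉ ∷ u) {f0} {f0} e = refl
lookup-injective-unique {xs = x ∷ xs} (x∉ ∷ u) {f0} {fs j} e = ⊥-elim (All.lookup x∉ (∈-lookup j) e)
lookup-injective-unique {xs = x ∷ xs} (x∉ ∷ u) {fs i} {f0} e = ⊥-elim (All.lookup x∉ (∈-lookup i) (sym e))
lookup-injective-unique {xs = x ∷ xs} (x∉ ∷ u) {fs i} {fs j} e = cong fs (lookup-injective-unique u e)

-- The extremal graph: a complete bipartite graph with a perfect matching left i – right i added in one of its parts.
data Vertex : Set where
  left right page : ℕ → Vertex

_~ᵛ_ : Vertex → Vertex → Bool
left i  ~ᵛ right j = i ≡ᵇ j
right i ~ᵛ left j  = i ≡ᵇ j
left _  ~ᵛ left _  = false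
right _ ~ᵛ right _ = false
page _  ~ᵛ page _  = false
_       ~ᵛ page _  = true
page _  ~ᵛ _       = true

≡ᵇ-sym : ∀ i j → (i ≡ᵇ j) ≡ (j ≡ᵇ i)
≡ᵇ-sym zero    zero    = refl
≡ᵇ-sym zero    (suc j) = refl
≡ᵇ-sym (suc i) zero    = refl
≡ᵇ-sym (suc i) (suc j) = ≡ᵇ-sym i j

~ᵛ-sym : ∀ x y → x ~ᵛ y ≡ y ~ᵛ x
~ᵛ-sym (left i)  (left j)  = refl
~ᵛ-sym (left i)  (right j) = ≡ᵇ-sym i j
~ᵛ-sym (left i)  (page j)  = refl
~ᵛ-sym (right i) (left j)  = ≡ᵇ-sym i j
~ᵛ-sym (right i) (right j) = refl
~ᵛ-sym (right i) (page j)  = refl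
~ᵛ-sym (page i)  (left j)  = refl
~ᵛ-sym (page i)  (right j) = refl
~ᵛ-sym (page i)  (page j)  = refl

~ᵛ-irrefl : ∀ x → x ~ᵛ x ≡ false
~ᵛ-irrefl (left i)  = refl
~ᵛ-irrefl (right i) = refl
~ᵛ-irrefl (page i)  = refl

mate : Vertex → Vertex
mate (left i)  = right i
mate (right i) = left i
mate (page i)  = page i

IsPage : Vertex → Set
IsPage x = ∃ λ i → x ≡ page i

≡ᵇ⇒≡′ : ∀ {i j} → (i ≡ᵇ j) ≡ true → i ≡ j
≡ᵇ⇒≡′ {i} {j} e = ≡ᵇ⇒≡ i j (Equivalence.from Bool.T-≡ e)

neighbour : ∀ {x y} → x ~ᵛ y ≡ true → ¬ IsPage x → IsPage y ⊎ y ≡ mate x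
neighbour {left i}  {right j} e _ = inj₂ (cong right (sym (≡ᵇ⇒≡′ e)))
neighbour {left i}  {page j}  e _ = inj₁ (j , refl)
neighbour {right i} {left j}  e _ = inj₂ (cong left (sym (≡ᵇ⇒≡′ e)))
neighbour {right i} {page j}  e _ = inj₁ (j , refl)
neighbour {page i}  e ¬p = ⊥-elim (¬p (i , refl))

pages-independent : ∀ {x y} → x ~ᵛ y ≡ true → IsPage x → IsPage y → ⊥
pages-independent () (_ , refl) (_ , refl)

isPage? : ∀ x → Dec (IsPage x)
isPage? (left i)  = no λ ()
isPage? (right i) = no λ ()
isPage? (page i)  = yes (i , refl)

-- Around a page the link is a matching, and around any other vertex it is a star centred at the mate.
noP̂₄-Vertex : ∀ {v a b c d} → v ~ᵛ a ≡ true → v ~ᵛ b ≡ true → v ~ᵛ c ≡ true → v ~ᵛ d ≡ true →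
  a ~ᵛ b ≡ true → b ~ᵛ c ≡ true → c ~ᵛ d ≡ true → a ≢ c → b ≢ d → a ≢ d → ⊥
noP̂₄-Vertex {v} {a} {b} {c} {d} va vb vc vd ab bc cd a≢c b≢d a≢d with isPage? v
... | yes pv = a≢c (trans (mate-of (trans (~ᵛ-sym b a) ab) va) (sym (mate-of bc vc)))
  where
  not-page : ∀ {x} → v ~ᵛ x ≡ true → ¬ IsPage x
  not-page vx = pages-independent vx pv
  mate-of : ∀ {x} → b ~ᵛ x ≡ true → v ~ᵛ x ≡ true → x ≡ mate b
  mate-of bx vx with neighbour bx (not-page vb)
  ... | inj₁ px = ⊥-elim (not-page vx px)
  ... | inj₂ e  = e
-- No path edge joins two pages, so the vertices equal to the mate of v cover all three edges. A
-- cover needs two of the four vertices, and these would coincide.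
... | no ¬pv with neighbour va ¬pv | neighbour vb ¬pv | neighbour vc ¬pv | neighbour vd ¬pv
... | inj₁ pa | inj₁ pb | _ | _ = pages-independent ab pa pb
... | _ | inj₁ pb | inj₁ pc | _ = pages-independent bc pb pc
... | _ | _ | inj₁ pc | inj₁ pd = pages-independent cd pc pd
... | inj₂ ea | _ | inj₂ ec | _ = a≢c (trans ea (sym ec))
... | inj₂ ea | _ | _ | inj₂ ed = a≢d (trans ea (sym ed))
... | _ | inj₂ eb | _ | inj₂ ed = b≢d (trans eb (sym ed))
... | _ | inj₂ refl | inj₂ refl | _ with () ← trans (sym bc) (~ᵛ-irrefl (mate v))

pages : ℕ → List Vertex
pages zero    = []
pages (suc b) = page b ∷ pages b

vertices : ℕ → ℕ → List Vertex
vertices zero    b = pages b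
vertices (suc p) b = left p ∷ right p ∷ vertices p b

length-pages : ∀ b → length (pages b) ≡ b
length-pages zero    = refl
length-pages (suc b) = cong suc (length-pages b)

length-vertices : ∀ p b → length (vertices p b) ≡ p * 2 + b
length-vertices zero    b = length-pages b
length-vertices (suc p) b = cong (2 +_) (length-vertices p b)

∈-pages : ∀ {b x} → x ∈ pages b → ∃ λ i → i < b × x ≡ page i
∈-pages {suc b} (here refl) = b , ≤-refl , refl
∈-pages {suc b} (there x∈)  = let i , i<b , e = ∈-pages x∈ in i , m≤n⇒m≤1+n i<b , e

Below : ℕ → Vertex → Set
Below p x = (∃ λ i → i < p × (x ≡ left i ⊎ x ≡ right i)) ⊎ IsPage x

∈-vertices : ∀ {p b x} → x ∈ vertices p b → Below p x
∈-vertices {zero}  x∈ = let i , _ , e = ∈-pages x∈ in inj₂ (i , e)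
∈-vertices {suc p} (here e)          = inj₁ (p , ≤-refl , inj₁ e)
∈-vertices {suc p} (there (here e))  = inj₁ (p , ≤-refl , inj₂ e)
∈-vertices {suc p} (there (there x∈)) with ∈-vertices {p} x∈
... | inj₁ (i , i<p , e) = inj₁ (i , m≤n⇒m≤1+n i<p , e)
... | inj₂ page-x        = inj₂ page-x

pages-unique : ∀ b → Unique (pages b)
pages-unique zero    = []
pages-unique (suc b) = All.tabulate (λ { x∈ refl → case-self (∈-pages x∈) }) ∷ pages-unique b
  where
  case-self : (∃ λ i → i < b × page b ≡ page i) → ⊥
  case-self (i , i<b , refl) = <-irrefl refl i<b

vertices-unique : ∀ p b → Unique (vertices p b)
vertices-unique zero    b = pages-unique b
vertices-unique (suc p) b =
  ((λ ()) ∷ All.tabulate (λ { x∈ refl → fresh-left (∈-vertices {p} x∈) })) ∷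
  All.tabulate (λ { x∈ refl → fresh-right (∈-vertices {p} x∈) }) ∷ vertices-unique p b
  where
  fresh-left : ¬ Below p (left p)
  fresh-left (inj₁ (i , i<p , inj₁ refl)) = <-irrefl refl i<p
  fresh-left (inj₁ (i , i<p , inj₂ ()))
  fresh-left (inj₂ (_ , ()))
  fresh-right : ¬ Below p (right p)
  fresh-right (inj₁ (i , i<p , inj₁ ()))
  fresh-right (inj₁ (i , i<p , inj₂ refl)) = <-irrefl refl i<p
  fresh-right (inj₂ (_ , ()))

module VertexCounting = Counting (_~ᵇ?_ _~ᵛ_ ~ᵛ-sym ~ᵛ-irrefl)
open VertexCounting

tri-pages : ∀ b → tri (pages b) ≡ 0
tri-pages b = tri-independent (pages b) λ x∈ y∈ → pages-apart (∈-pages x∈) (∈-pages y∈)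
  where
  pages-apart : ∀ {x y} → (∃ λ i → i < b × x ≡ page i) → (∃ λ i → i < b × y ≡ page i) → ¬ (x ~ᵛ y ≡ true)
  pages-apart (_ , _ , refl) (_ , _ , refl) ()
  tri-independent : ∀ L → (∀ {x y} → x ∈ L → y ∈ L → ¬ (x ~ᵛ y ≡ true)) → tri L ≡ 0
  tri-independent [] h = refl
  tri-independent (x ∷ L) h rewrite N-none x L (λ y∈ → h (here refl) (there y∈)) =
    tri-independent L (λ x∈ y∈ → h (there x∈) (there y∈))

edges-pages : ∀ b → edges (pages b) ≡ 0
edges-pages zero = refl
edges-pages (suc b) rewrite N-none (page b) (pages b) (λ y∈ e → pages-independent e (b , refl) (let i , _ , q = ∈-pages y∈ in i , q)) =
  edges-pages b

-- Since q is at least p, the mate of x is not in the list, and only pages remain as neighbours.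
N-vertices : ∀ {x q} p b → p ≤ q → x ≡ left q ⊎ x ≡ right q → N x (vertices p b) ≡ pages b
N-vertices {x} zero b _ x≡ = N-all x (pages b) λ y∈ → adjacent x≡ (∈-pages y∈)
  where
  adjacent : ∀ {x y q} → x ≡ left q ⊎ x ≡ right q → (∃ λ i → i < b × y ≡ page i) → x ~ᵛ y ≡ true
  adjacent (inj₁ refl) (_ , _ , refl) = refl
  adjacent (inj₂ refl) (_ , _ , refl) = refl
N-vertices {x} {q} (suc p) b p<q x≡ =
  trans (N-no {x} {left p} (right p ∷ vertices p b) (no-left x≡))
    (trans (N-no {x} {right p} (vertices p b) (no-right x≡)) (N-vertices p b (<⇒≤ p<q) x≡))
  where
  q≢p : ¬ ((q ≡ᵇ p) ≡ true)
  q≢p e = <-irrefl (sym (≡ᵇ⇒≡′ e)) p<q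
  no-left : x ≡ left q ⊎ x ≡ right q → ¬ (x ~ᵛ left p ≡ true)
  no-left (inj₁ refl) ()
  no-left (inj₂ refl) = q≢p
  no-right : x ≡ left q ⊎ x ≡ right q → ¬ (x ~ᵛ right p ≡ true)
  no-right (inj₁ refl) = q≢p
  no-right (inj₂ refl) ()

≡ᵇ-refl : ∀ i → (i ≡ᵇ i) ≡ true
≡ᵇ-refl zero    = refl
≡ᵇ-refl (suc i) = ≡ᵇ-refl i

-- Every triangle is a matched pair with a page: among the later vertices, the link of `left p` is a
-- star from `right p` to the b pages, and that of `right p` is independent.
tri-vertices : ∀ p b → tri (vertices p b) ≡ p * b
tri-vertices zero    b = tri-pages b
tri-vertices (suc p) b = begin
  edges (N (left p) (right p ∷ K)) + (edges (N (right p) K) + tri K)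
    ≡⟨ cong₂ (λ M M′ → edges M + (edges M′ + tri K))
         (trans (N-yes {left p} {right p} K (≡ᵇ-refl p)) (cong (right p ∷_) (N-vertices p b ≤-refl (inj₁ refl))))
         (N-vertices p b ≤-refl (inj₂ refl)) ⟩
  length (N (right p) (pages b)) + edges (pages b) + (edges (pages b) + tri K)
    ≡⟨ cong₂ _+_ (cong₂ _+_ (trans (cong length (N-vertices {q = p} 0 b z≤n (inj₂ refl))) (length-pages b)) (edges-pages b))
         (cong₂ _+_ (edges-pages b) (tri-vertices p b)) ⟩
  b + 0 + p * b
    ≡⟨ cong (_+ p * b) (+-identityʳ b) ⟩
  b + p * b ∎
  where
  open ≡-Reasoning
  K = vertices p b

Attained : ℕ → ℕ → Set
Attained n m = Σ (Graph n) λ G → Free G P4hat × triangles G ≡ m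

matching-join : ∀ p b → Attained (p * 2 + b) (p * b)
matching-join p b = subst (λ n → Attained n (p * b)) (length-vertices p b)
  (G , noP̂₄⇒free G noP , trans (triangles-listGraph _~ᵛ_ ~ᵛ-sym ~ᵛ-irrefl vs) (tri-vertices p b))
  where
  vs = vertices p b
  G = listGraph _~ᵛ_ ~ᵛ-sym ~ᵛ-irrefl vs
  inj : ∀ {i j} → i ≢ j → List.lookup vs i ≢ List.lookup vs j
  inj i≢j e = i≢j (lookup-injective-unique (vertices-unique p b) e)
  noP : NoP̂₄ G
  noP v a va b vb ab c vc bc a≢c d vd cd b≢d a≢d =
    noP̂₄-Vertex {List.lookup vs v} va vb vc vd ab bc cd (inj a≢c) (inj b≢d) (inj a≢d)

floor-8 : ∀ {n r m} → n ≡ r + m * 8 → r < 8 → n / 8 ≡ m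
floor-8 {r = r} {m} refl r<8 = trans (+-distrib-/-∣ʳ r (divides-refl m))
  (cong₂ _+_ (m<n⇒m/n≡0 r<8) (m*n/n≡m m 8))

-- The choice is p = ⌊(n + 1)/4⌋ matched pairs and b = n ∸ 2p pages. Then n² ∸ 8pb is 0, 1, 4, 1 for
-- n congruent to 0, 1, 2, 3 modulo 4, always below 8.
attained-n²/8 : ∀ n → Attained n (n * n / 8)
attained-n²/8 n with n % 4 | m%n<n n 4 | n / 4 | m≡m%n+[m/n]*n n 4
... | 0 | _ | q | refl = subst₂ Attained (size q) (sym (floor-8 {r = 0} (square q) (s≤s z≤n))) (matching-join q (2 * q))
  where
  size : ∀ q → q * 2 + 2 * q ≡ q * 4
  size = solve-∀
  square : ∀ q → (q * 4) * (q * 4) ≡ q * (2 * q) * 8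
  square = solve-∀
... | 1 | _ | q | refl = subst₂ Attained (size q) (sym (floor-8 {r = 1} (square q) (s≤s (s≤s z≤n)))) (matching-join q (1 + 2 * q))
  where
  size : ∀ q → q * 2 + (1 + 2 * q) ≡ 1 + q * 4
  size = solve-∀
  square : ∀ q → (1 + q * 4) * (1 + q * 4) ≡ 1 + q * (1 + 2 * q) * 8
  square = solve-∀
... | 2 | _ | q | refl = subst₂ Attained (size q) (sym (floor-8 {r = 4} (square q) (s≤s (s≤s (s≤s (s≤s (s≤s z≤n))))))) (matching-join q (2 + 2 * q))
  where
  size : ∀ q → q * 2 + (2 + 2 * q) ≡ 2 + q * 4
  size = solve-∀
  square : ∀ q → (2 + q * 4) * (2 + q * 4) ≡ 4 + q * (2 + 2 * q) * 8
  square = solve-∀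
... | 3 | _ | q | refl = subst₂ Attained (size q) (sym (floor-8 {r = 1} (square q) (s≤s (s≤s z≤n)))) (matching-join (1 + q) (1 + 2 * q))
  where
  size : ∀ q → (1 + q) * 2 + (1 + 2 * q) ≡ 3 + q * 4
  size = solve-∀
  square : ∀ q → (3 + q * 4) * (3 + q * 4) ≡ 1 + (1 + q) * (1 + 2 * q) * 8
  square = solve-∀
... | suc (suc (suc (suc _))) | s≤s (s≤s (s≤s (s≤s ()))) | _ | _

-- The cliques {0,1,2,3} and {3,…,n-1} share the vertex 3; for 4 ≤ n ≤ 7 this graph is extremal.
twoCliques : ∀ n → Graph n
twoCliques n = record
  { adj    = λ i j → not (toℕ i ≡ᵇ toℕ j) ∧ together (toℕ i) (toℕ j)
  ; sym    = λ i j → cong₂ _∧_ (cong not (≡ᵇ-sym (toℕ i) (toℕ j)))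
      (cong₂ _∨_ (Bool.∧-comm (toℕ i ≤ᵇ 3) (toℕ j ≤ᵇ 3)) (Bool.∧-comm (3 ≤ᵇ toℕ i) (3 ≤ᵇ toℕ j)))
  ; irrefl = λ i → cong (λ b → not b ∧ together (toℕ i) (toℕ i)) (≡ᵇ-refl (toℕ i))
  }
  where
  together : ℕ → ℕ → Bool
  together i j = (i ≤ᵇ 3) ∧ (j ≤ᵇ 3) ∨ (3 ≤ᵇ i) ∧ (3 ≤ᵇ j)

-- Freeness is decided by evaluation through the implicit argument, and the triangle count is the
-- computed value.
small-attained : ∀ n {noP : True (noP̂₄? (twoCliques n))} → Attained n (triangles (twoCliques n))
small-attained n {noP} = twoCliques n , noP̂₄⇒free (twoCliques n) (toWitness noP) , refl

theorem1 : ((n : ℕ) → 8 ≤ n → ExK3 n P4hat ((n * n) / 8))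
    × ExK3 4 P4hat 4 × ExK3 5 P4hat 4 × ExK3 6 P4hat 5 × ExK3 7 P4hat 8
theorem1 = (λ n 8≤n → attained-n²/8 n , λ G free → triangles≤n²/8 G free 8≤n)
  -- For n = 4, 5, 6 the K₄-free bounds ⌊n²/8⌋ are 2, 3, 4, and the bounds (8 + x)/2 with x = n ∸ 4
  -- for graphs containing a K₄ are 4, 9/2, 5.
  , (small-attained 4 , λ G free → triangles≤small G free 4 refl z≤n (m≤m+n 2 2) (n≤1+n 8))
  , (small-attained 5 , λ G free → triangles≤small G free 4 refl (s≤s z≤n) (m≤m+n 3 1) ≤-refl)
  , (small-attained 6 , λ G free → triangles≤small G free 5 refl ≤-refl (m≤m+n 4 1) (n≤1+n 10))
  , (small-attained 7 , λ G free → triangles≤8 G free refl)
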